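{- Let $(\mathcal{V},\mathcal{E},\alpha)$ be a magnetic graph. The difference magnetic operator satisfies the following gauge invariance: for every real function $f:\mathcal{V}\to\mathbb{R}$ and every $g\in\mathcal{C}(\mathcal{V})$, $$d^0_{\alpha+d^0f}(e^{if}.g)=e^{if}.\,d^0_\alpha(g).$$
   Context: A magnetic graph consists of an at most countable vertex set $\mathcal{V}$, a symmetric edge set $\mathcal{E}\subset\mathcal{V}\times\mathcal{V}$ without loops (the graph is assumed connected and locally finite), and a magnetic potential $\alpha:\mathcal{E}\to\mathbb{R}$ with $\alpha(x,y)=-\alpha(y,x)$. $\mathcal{C}(\mathcal{V})$ is the set of functions $\mathcal{V}\to\mathbb{C}$; $\mathcal{C}_{skew}(\mathcal{E})$ is the set of $\varphi:\mathcal{E}\to\mathbb{C}$ with $\varphi(x,y)=-\varphi(y,x)$. Let $d^0f(x,y)=f(y)-f(x)$. The difference magnetic operator is $d^0_\alpha:\mathcal{C}(\mathcal{V})\to\mathcal{C}_{skew}(\mathcal{E})$, $d^0_\alpha g(x,y)=e^{\frac{i\alpha(y,x)}2}g(y)-e^{\frac{i\alpha(x,y)}2}g(x)$. The change of gauge given by a real function $f$ on $\mathcal{V}$ acts on $g\in\mathcal{C}(\mathcal{V})$ by $(e^{if}.g)(x)=e^{if(x)}g(x)$ and on $\varphi\in\mathcal{C}_{skew}(\mathcal{E})$ by $(e^{if}.\varphi)(x,y)=e^{i\tilde f(x,y)}\varphi(x,y)$ with $\tilde f(x,y)=\frac{f(x)+f(y)}2$. -}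

module Defs where

open import Level using (Level; 0ℓ) renaming (suc to lsuc; _⊔_ to _⊔ˡ_)
open import Algebra.Bundles using (CommutativeRing; AbelianGroup)
open import Data.Fin.Base using (Fin)
open import Data.Integer.Base using (+_)
import Data.Integer.Base as ℤ
import Data.Integer.Properties as ℤₚ
open import Data.Nat.Base as ℕ using (ℕ; zero; suc)
import Data.Nat.Properties as ℕₚ
open import Data.Product.Base using (Σ; ∃; _×_; _,_; proj₁; proj₂)
open import Data.Rational.Base
import Data.Rational.Unnormalised.Base as ℚᵘ
import Data.Rational.Unnormalised.Properties as ℚᵘₚ
open import Data.Rational.Properties
open import Data.Rational.Solver using (module +-*-Solver)
open import Function.Bundles using (_↣_; _↔_)
open import Relation.Binary.Construct.Closure.ReflexiveTransitive using (Star)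
open import Relation.Binary.Core using (Rel)
open import Relation.Binary.Definitions
  using (Symmetric; Irreflexive; Irrelevant; Universal)
open import Relation.Binary.PropositionalEquality
  using (_≡_; refl; sym; trans; cong; cong₂; subst; subst₂)
open import Relation.Binary.Structures using (IsEquivalence)

open +-*-Solver using (solve; con; _:=_; _:+_; _:*_; _:-_; :-_)

------------------------------------------------------------------------

ι : ℕ → ℚ
ι n = + n / 1

ι-suc : ∀ n → ι (suc n) ≡ 1ℚ + ι n
ι-suc n = toℚᵘ-injective (begin
  toℚᵘ (ι (suc n))              ≈⟨ toℚᵘ-fromℚᵘ (ℚᵘ.mkℚᵘ (+ suc n) 0) ⟩
  ℚᵘ.mkℚᵘ (+ suc n) 0           ≈⟨ ℚᵘ.*≡* (cong (ℤ._* (+ 1)) (cong (λ i → (+ 1) ℤ.+ i) (sym (ℤₚ.*-identityʳ (+ n))))) ⟩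
  ℚᵘ.mkℚᵘ (+ 1) 0 ℚᵘ.+ ℚᵘ.mkℚᵘ (+ n) 0
    ≈⟨ ℚᵘₚ.+-cong (ℚᵘₚ.≃-refl {ℚᵘ.mkℚᵘ (+ 1) 0}) (ℚᵘₚ.≃-sym (toℚᵘ-fromℚᵘ (ℚᵘ.mkℚᵘ (+ n) 0))) ⟩
  toℚᵘ 1ℚ ℚᵘ.+ toℚᵘ (ι n)       ≈⟨ ℚᵘₚ.≃-sym (toℚᵘ-homo-+ 1ℚ (ι n)) ⟩
  toℚᵘ (1ℚ + ι n) ∎)
  where open ℚᵘₚ.≃-Reasoning

1/suc*ι : ∀ n → (+ 1 / suc n) * ι (suc n) ≡ 1ℚ
1/suc*ι n = toℚᵘ-injective (begin
  toℚᵘ ((+ 1 / suc n) * ι (suc n))            ≈⟨ toℚᵘ-homo-* (+ 1 / suc n) (ι (suc n)) ⟩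
  toℚᵘ (+ 1 / suc n) ℚᵘ.* toℚᵘ (ι (suc n))
    ≈⟨ ℚᵘₚ.*-cong (toℚᵘ-fromℚᵘ (ℚᵘ.mkℚᵘ (+ 1) n)) (toℚᵘ-fromℚᵘ (ℚᵘ.mkℚᵘ (+ suc n) 0)) ⟩
  ℚᵘ.mkℚᵘ (+ 1) n ℚᵘ.* ℚᵘ.mkℚᵘ (+ suc n) 0
    ≈⟨ ℚᵘ.*≡* (trans (ℤₚ.*-identityʳ ((+ 1) ℤ.* (+ suc n))) (cong (λ k → (+ 1) ℤ.* (+ suc k)) (sym (ℕₚ.*-identityʳ n)))) ⟩
  ℚᵘ.1ℚᵘ ∎)
  where open ℚᵘₚ.≃-Reasoning

0≤1/suc : ∀ n → 0ℚ ≤ + 1 / suc n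
0≤1/suc n = nonNegative⁻¹ (+ 1 / suc n) {{normalize-nonNeg 1 (suc n)}}

0≤1ℚ : 0ℚ ≤ 1ℚ
0≤1ℚ = nonNegative⁻¹ 1ℚ

0<1ℚ : 0ℚ < 1ℚ
0<1ℚ = positive⁻¹ 1ℚ

p≤p+q : ∀ {p q} → 0ℚ ≤ q → p ≤ p + q
p≤p+q {p} {q} 0≤q = subst (_≤ p + q) (+-identityʳ p) (+-monoʳ-≤ p 0≤q)

p≤q+p : ∀ {p q} → 0ℚ ≤ q → p ≤ q + p
p≤q+p {p} {q} 0≤q = subst (p ≤_) (+-comm p q) (p≤p+q 0≤q)

0≤+ : ∀ {p q} → 0ℚ ≤ p → 0ℚ ≤ q → 0ℚ ≤ p + q
0≤+ 0≤p 0≤q = ≤-trans 0≤p (p≤p+q 0≤q)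

*-monoˡ : ∀ {r p q} → 0ℚ ≤ r → p ≤ q → r * p ≤ r * q
*-monoˡ {r} 0≤r = *-monoˡ-≤-nonNeg r {{nonNegative 0≤r}}

*-monoʳ : ∀ {r p q} → 0ℚ ≤ r → p ≤ q → p * r ≤ q * r
*-monoʳ {r} 0≤r = *-monoʳ-≤-nonNeg r {{nonNegative 0≤r}}

*-mono : ∀ {p q r s} → 0ℚ ≤ r → 0ℚ ≤ q → p ≤ q → r ≤ s → p * r ≤ q * s
*-mono 0≤r 0≤q p≤q r≤s = ≤-trans (*-monoʳ 0≤r p≤q) (*-monoˡ 0≤q r≤s)

0≤* : ∀ {p q} → 0ℚ ≤ p → 0ℚ ≤ q → 0ℚ ≤ p * q
0≤* {p} {q} 0≤p 0≤q = subst (_≤ p * q) (*-zeroʳ p) (*-monoˡ 0≤p 0≤q)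

0≤ι : ∀ n → 0ℚ ≤ ι n
0≤ι n = nonNegative⁻¹ (ι n) {{normalize-nonNeg n 1}}

ι-mono : ∀ {m n} → m ℕ.≤ n → ι m ≤ ι n
ι-mono {n = n} ℕ.z≤n = 0≤ι n
ι-mono {suc m} {suc n} (ℕ.s≤s m≤n) =
  subst₂ _≤_ (sym (ι-suc m)) (sym (ι-suc n)) (+-monoʳ-≤ 1ℚ (ι-mono m≤n))

-- Some natural number lies above p: the absolute value of its numerator.
≤ι : ∀ p → ∃ λ n → p ≤ ι n
≤ι p@record{} = n , toℚᵘ-cancel-≤
  (ℚᵘₚ.≤-trans p≤n (ℚᵘₚ.≤-reflexive (ℚᵘₚ.≃-sym (toℚᵘ-fromℚᵘ (ℚᵘ.mkℚᵘ (+ n) 0)))))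
  where
  n = ℤ.∣ ↥ p ∣
  p≤∣p∣ : ∀ i → i ℤ.≤ + ℤ.∣ i ∣
  p≤∣p∣ (+ _)        = ℤₚ.≤-refl
  p≤∣p∣ (ℤ.-[1+ _ ]) = ℤ.-≤+
  p≤n : toℚᵘ p ℚᵘ.≤ ℚᵘ.mkℚᵘ (+ n) 0
  p≤n = ℚᵘ.*≤* (begin
    ↥ p ℤ.* (+ 1)   ≡⟨ ℤₚ.*-identityʳ (↥ p) ⟩
    ↥ p             ≤⟨ p≤∣p∣ (↥ p) ⟩
    + n             ≤⟨ ℤ.+≤+ (ℕₚ.m≤m*n n (↧ₙ p)) ⟩
    + (n ℕ.* ↧ₙ p)  ≡⟨ ℤₚ.pos-* n (↧ₙ p) ⟩
    (+ n) ℤ.* (↧ p) ∎)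
    where open ℤₚ.≤-Reasoning

from : ∀ {P : ℕ → Set} N → (∀ j → P (j ℕ.+ N)) → ∀ {n} → N ℕ.≤ n → P n
from {P} N P[j+N] {n} N≤n = subst P (ℕₚ.m∸n+n≡m N≤n) (P[j+N] (n ℕ.∸ N))

module _ where
  open ≤-Reasoning

  archimedean : ∀ {δ} → 0ℚ < δ → ∃ λ N → ∀ {n} → N ℕ.≤ n → 1ℚ ≤ ι n * δ
  archimedean {δ} 0<δ = N , λ {n} N≤n → begin
    1ℚ         ≡⟨ sym (*-inverseˡ δ {{δ≢0}}) ⟩
    δ⁻¹ * δ    ≤⟨ *-monoʳ (<⇒≤ 0<δ) (≤-trans (proj₂ (≤ι δ⁻¹)) (ι-mono N≤n)) ⟩
    ι n * δ    ∎
    where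
    δ≢0 = >-nonZero 0<δ
    δ⁻¹ = (1/ δ) {{δ≢0}}
    N = proj₁ (≤ι δ⁻¹)

  shrink : ∀ {C} → 0ℚ ≤ C → ∀ {ε} → 0ℚ < ε → ∃ λ δ → 0ℚ < δ × C * δ < ε
  shrink {C} 0≤C {ε} 0<ε = δ , 0<δ , (begin-strict
    C * δ        ≡⟨ +-identityˡ (C * δ) ⟨
    0ℚ + C * δ   <⟨ +-monoˡ-< (C * δ) 0<δ ⟩
    δ + C * δ    ≡⟨ solve 3 (λ c e d → d :* e :+ c :* (d :* e) := (d :* (con 1ℚ :+ c)) :* e) refl C ε D⁻¹ ⟩
    D⁻¹ * D * ε  ≡⟨ cong (_* ε) (*-inverseˡ D {{D≢0}}) ⟩
    1ℚ * ε       ≡⟨ *-identityˡ ε ⟩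
    ε            ∎)
    where
    D = 1ℚ + C
    0<D : 0ℚ < D
    0<D = <-≤-trans 0<1ℚ (p≤p+q 0≤C)
    D≢0 = >-nonZero 0<D
    D⁻¹ = (1/ D) {{D≢0}}
    δ = D⁻¹ * ε
    0<δ : 0ℚ < δ
    0<δ = positive⁻¹ δ {{pos*pos⇒pos D⁻¹ {{1/pos⇒pos D {{positive 0<D}}}} ε {{positive 0<ε}}}}

  ∣-∣-triangle : ∀ p q r → ∣ p - r ∣ ≤ ∣ p - q ∣ + ∣ q - r ∣
  ∣-∣-triangle p q r = begin
    ∣ p - r ∣                ≡⟨ cong ∣_∣ (solve 3 (λ p q r → p :- r := (p :- q) :+ (q :- r)) refl p q r) ⟩
    ∣ (p - q) + (q - r) ∣    ≤⟨ ∣p+q∣≤∣p∣+∣q∣ (p - q) (q - r) ⟩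
    ∣ p - q ∣ + ∣ q - r ∣    ∎

  ∣-∣-swap : ∀ p q → ∣ p - q ∣ ≡ ∣ q - p ∣
  ∣-∣-swap p q = trans (cong ∣_∣ (solve 2 (λ p q → p :- q := :- (q :- p)) refl p q)) (∣-p∣≡∣p∣ (q - p))

  ∣-∣-+ : ∀ p q r s → ∣ (p + q) - (r + s) ∣ ≤ ∣ p - r ∣ + ∣ q - s ∣
  ∣-∣-+ p q r s = begin
    ∣ (p + q) - (r + s) ∣   ≡⟨ cong ∣_∣ (solve 4 (λ p q r s → (p :+ q) :- (r :+ s) := (p :- r) :+ (q :- s)) refl p q r s) ⟩
    ∣ (p - r) + (q - s) ∣   ≤⟨ ∣p+q∣≤∣p∣+∣q∣ (p - r) (q - s) ⟩
    ∣ p - r ∣ + ∣ q - s ∣   ∎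

  ∣-∣-neg : ∀ p q → ∣ (- p) - (- q) ∣ ≡ ∣ p - q ∣
  ∣-∣-neg p q = trans (cong ∣_∣ (solve 2 (λ p q → (:- p) :- (:- q) := q :- p) refl p q)) (∣-∣-swap q p)

  ∣-∣-* : ∀ p q r s → ∣ p * q - r * s ∣ ≤ ∣ p ∣ * ∣ q - s ∣ + ∣ p - r ∣ * ∣ s ∣
  ∣-∣-* p q r s = begin
    ∣ p * q - r * s ∣                        ≡⟨ cong ∣_∣ (solve 4 (λ p q r s → p :* q :- r :* s := p :* (q :- s) :+ (p :- r) :* s) refl p q r s) ⟩
    ∣ p * (q - s) + (p - r) * s ∣            ≤⟨ ∣p+q∣≤∣p∣+∣q∣ (p * (q - s)) ((p - r) * s) ⟩
    ∣ p * (q - s) ∣ + ∣ (p - r) * s ∣        ≡⟨ cong₂ _+_ (∣p*q∣≡∣p∣*∣q∣ p (q - s)) (∣p*q∣≡∣p∣*∣q∣ (p - r) s) ⟩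
    ∣ p ∣ * ∣ q - s ∣ + ∣ p - r ∣ * ∣ s ∣    ∎

------------------------------------------------------------------------

-- ℝ is the setoid of Cauchy sequences of rationals, two of which are equal
-- (_≈ᴿ_) when their difference tends to zero.
Cauchy : (ℕ → ℚ) → Set
Cauchy a = ∀ {ε} → 0ℚ < ε → ∃ λ N → ∀ {m n} → N ℕ.≤ m → N ℕ.≤ n → ∣ a m - a n ∣ < ε

record ℝ : Set where
  no-eta-equality
  field
    seq    : ℕ → ℚ
    cauchy : Cauchy seq

open ℝ public

infix 4 _≈ᴿ_
record _≈ᴿ_ (x y : ℝ) : Set where
  no-eta-equality
  field
    close : ∀ {ε} → 0ℚ < ε → ∃ λ N → ∀ {n} → N ℕ.≤ n → ∣ seq x n - seq y n ∣ < ε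

open _≈ᴿ_ public

-- A Cauchy or equality estimate up to a constant factor suffices.
cauchy-up-to : ∀ a {C} → 0ℚ ≤ C →
  (∀ {δ} → 0ℚ < δ → ∃ λ N → ∀ {m n} → N ℕ.≤ m → N ℕ.≤ n → ∣ a m - a n ∣ ≤ C * δ) → Cauchy a
cauchy-up-to a 0≤C est 0<ε =
  let δ , 0<δ , Cδ<ε = shrink 0≤C 0<ε
      N , bnd = est 0<δ
  in N , λ N≤m N≤n → ≤-<-trans (bnd N≤m N≤n) Cδ<ε

≈-up-to : ∀ {x y C} → 0ℚ ≤ C →
  (∀ {δ} → 0ℚ < δ → ∃ λ N → ∀ {n} → N ℕ.≤ n → ∣ seq x n - seq y n ∣ ≤ C * δ) → x ≈ᴿ y
≈-up-to 0≤C est .close 0<ε =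
  let δ , 0<δ , Cδ<ε = shrink 0≤C 0<ε
      N , bnd = est 0<δ
  in N , λ N≤n → ≤-<-trans (bnd N≤n) Cδ<ε

eventually-bounded : ∀ x → ∃ λ B → 0ℚ ≤ B × ∃ λ N → ∀ {n} → N ℕ.≤ n → ∣ seq x n ∣ ≤ B
eventually-bounded x = let N , bnd = cauchy x 0<1ℚ in
  1ℚ + ∣ seq x N ∣ , 0≤+ 0≤1ℚ (0≤∣p∣ (seq x N)) , N , λ {n} N≤n → begin
    ∣ seq x n ∣                            ≡⟨ cong ∣_∣ (solve 2 (λ p q → p := (p :- q) :+ q) refl (seq x n) (seq x N)) ⟩
    ∣ (seq x n - seq x N) + seq x N ∣      ≤⟨ ∣p+q∣≤∣p∣+∣q∣ (seq x n - seq x N) (seq x N) ⟩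
    ∣ seq x n - seq x N ∣ + ∣ seq x N ∣    ≤⟨ +-monoˡ-≤ ∣ seq x N ∣ (<⇒≤ (bnd N≤n ℕₚ.≤-refl)) ⟩
    1ℚ + ∣ seq x N ∣                       ∎
  where open ≤-Reasoning

pointwise : ∀ {x y} → (∀ n → seq x n ≡ seq y n) → x ≈ᴿ y
pointwise {x} {y} eq .close {ε} 0<ε = 0 , λ {n} _ →
  subst (λ p → ∣ p ∣ < ε) (sym (trans (cong (_- seq y n) (eq n)) (+-inverseʳ (seq y n)))) 0<ε

fromℚ : ℚ → ℝ
fromℚ p .seq _ = p
fromℚ p .cauchy {ε} 0<ε = 0 , λ _ _ → subst (λ q → ∣ q ∣ < ε) (sym (+-inverseʳ p)) 0<ε

infixl 6 _+ᴿ_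
infixl 7 _*ᴿ_
infix  8 -ᴿ_ _/2

2ℚ : ℚ
2ℚ = 1ℚ + 1ℚ

2* : ∀ p → p + p ≡ 2ℚ * p
2* = solve 1 (λ p → p :+ p := con 2ℚ :* p) refl

_+ᴿ_ : ℝ → ℝ → ℝ
(x +ᴿ y) .seq n = seq x n + seq y n
(x +ᴿ y) .cauchy = cauchy-up-to (λ n → seq x n + seq y n) {C = 2ℚ} (nonNegative⁻¹ 2ℚ) λ {δ} 0<δ →
  let N , p = cauchy x 0<δ
      M , q = cauchy y 0<δ
  in N ℕ.⊔ M , λ {m} {n} ≤m ≤n → begin
    ∣ (seq x m + seq y m) - (seq x n + seq y n) ∣    ≤⟨ ∣-∣-+ (seq x m) (seq y m) (seq x n) (seq y n) ⟩
    ∣ seq x m - seq x n ∣ + ∣ seq y m - seq y n ∣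
      ≤⟨ +-mono-≤ (<⇒≤ (p (ℕₚ.m⊔n≤o⇒m≤o N M ≤m) (ℕₚ.m⊔n≤o⇒m≤o N M ≤n)))
                  (<⇒≤ (q (ℕₚ.m⊔n≤o⇒n≤o N M ≤m) (ℕₚ.m⊔n≤o⇒n≤o N M ≤n))) ⟩
    δ + δ                                            ≡⟨ 2* δ ⟩
    2ℚ * δ                                           ∎
  where open ≤-Reasoning

-ᴿ_ : ℝ → ℝ
(-ᴿ x) .seq n = - seq x n
(-ᴿ x) .cauchy {ε} 0<ε = let N , p = cauchy x 0<ε in
  N , λ {m} {n} N≤m N≤n → subst (_< ε) (sym (∣-∣-neg (seq x m) (seq x n))) (p N≤m N≤n)

product-bound : ∀ p q r s {A B δ} → 0ℚ ≤ A → 0ℚ ≤ δ → ∣ p ∣ ≤ A → ∣ s ∣ ≤ B →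
  ∣ p - r ∣ ≤ δ → ∣ q - s ∣ ≤ δ → ∣ p * q - r * s ∣ ≤ (A + B) * δ
product-bound p q r s {A} {B} {δ} 0≤A 0≤δ p≤A s≤B p-r q-s = begin
  ∣ p * q - r * s ∣                        ≤⟨ ∣-∣-* p q r s ⟩
  ∣ p ∣ * ∣ q - s ∣ + ∣ p - r ∣ * ∣ s ∣
    ≤⟨ +-mono-≤ (*-mono (0≤∣p∣ (q - s)) 0≤A p≤A q-s) (*-mono (0≤∣p∣ s) 0≤δ p-r s≤B) ⟩
  A * δ + δ * B                            ≡⟨ solve 3 (λ a b d → a :* d :+ d :* b := (a :+ b) :* d) refl A B δ ⟩
  (A + B) * δ                              ∎
  where open ≤-Reasoning

_*ᴿ_ : ℝ → ℝ → ℝ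
(x *ᴿ y) .seq n = seq x n * seq y n
(x *ᴿ y) .cauchy =
  let A , 0≤A , K , x≤A = eventually-bounded x
      B , 0≤B , L , y≤B = eventually-bounded y
  in cauchy-up-to (λ n → seq x n * seq y n) (0≤+ 0≤A 0≤B) λ 0<δ →
  let N , p = cauchy x 0<δ
      M , q = cauchy y 0<δ
      NM = N ℕ.⊔ M
      KL = K ℕ.⊔ L
  in NM ℕ.⊔ KL , λ {m} {n} ≤m ≤n →
  let NM≤m = ℕₚ.m⊔n≤o⇒m≤o NM KL ≤m
      NM≤n = ℕₚ.m⊔n≤o⇒m≤o NM KL ≤n
  in product-bound (seq x m) (seq y m) (seq x n) (seq y n) 0≤A (<⇒≤ 0<δ)
       (x≤A (ℕₚ.m⊔n≤o⇒m≤o K L (ℕₚ.m⊔n≤o⇒n≤o NM KL ≤m)))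
       (y≤B (ℕₚ.m⊔n≤o⇒n≤o K L (ℕₚ.m⊔n≤o⇒n≤o NM KL ≤n)))
       (<⇒≤ (p (ℕₚ.m⊔n≤o⇒m≤o N M NM≤m) (ℕₚ.m⊔n≤o⇒m≤o N M NM≤n)))
       (<⇒≤ (q (ℕₚ.m⊔n≤o⇒n≤o N M NM≤m) (ℕₚ.m⊔n≤o⇒n≤o N M NM≤n)))

0ᴿ 1ᴿ : ℝ
0ᴿ = fromℚ 0ℚ
1ᴿ = fromℚ 1ℚ

_/2 : ℝ → ℝ
x /2 = fromℚ ½ *ᴿ x

≈ᴿ-refl : ∀ {x} → x ≈ᴿ x
≈ᴿ-refl = pointwise λ _ → refl

≈ᴿ-sym : ∀ {x y} → x ≈ᴿ y → y ≈ᴿ x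
≈ᴿ-sym {x} {y} x≈y .close {ε} 0<ε = let N , p = close x≈y 0<ε in
  N , λ {n} N≤n → subst (_< ε) (∣-∣-swap (seq x n) (seq y n)) (p N≤n)

≈ᴿ-trans : ∀ {x y z} → x ≈ᴿ y → y ≈ᴿ z → x ≈ᴿ z
≈ᴿ-trans {x} {y} {z} x≈y y≈z = ≈-up-to {C = 2ℚ} (nonNegative⁻¹ 2ℚ) λ {δ} 0<δ →
  let N , p = close x≈y 0<δ
      M , q = close y≈z 0<δ
  in N ℕ.⊔ M , λ {n} ≤n → begin
    ∣ seq x n - seq z n ∣                            ≤⟨ ∣-∣-triangle (seq x n) (seq y n) (seq z n) ⟩
    ∣ seq x n - seq y n ∣ + ∣ seq y n - seq z n ∣
      ≤⟨ +-mono-≤ (<⇒≤ (p (ℕₚ.m⊔n≤o⇒m≤o N M ≤n))) (<⇒≤ (q (ℕₚ.m⊔n≤o⇒n≤o N M ≤n))) ⟩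
    δ + δ                                            ≡⟨ 2* δ ⟩
    2ℚ * δ                                           ∎
  where open ≤-Reasoning

+ᴿ-cong : ∀ {x y u v} → x ≈ᴿ y → u ≈ᴿ v → x +ᴿ u ≈ᴿ y +ᴿ v
+ᴿ-cong {x} {y} {u} {v} x≈y u≈v = ≈-up-to {C = 2ℚ} (nonNegative⁻¹ 2ℚ) λ {δ} 0<δ →
  let N , p = close x≈y 0<δ
      M , q = close u≈v 0<δ
  in N ℕ.⊔ M , λ {n} ≤n → begin
    ∣ (seq x n + seq u n) - (seq y n + seq v n) ∣    ≤⟨ ∣-∣-+ (seq x n) (seq u n) (seq y n) (seq v n) ⟩
    ∣ seq x n - seq y n ∣ + ∣ seq u n - seq v n ∣
      ≤⟨ +-mono-≤ (<⇒≤ (p (ℕₚ.m⊔n≤o⇒m≤o N M ≤n))) (<⇒≤ (q (ℕₚ.m⊔n≤o⇒n≤o N M ≤n))) ⟩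
    δ + δ                                            ≡⟨ 2* δ ⟩
    2ℚ * δ                                           ∎
  where open ≤-Reasoning

-ᴿ-cong : ∀ {x y} → x ≈ᴿ y → -ᴿ x ≈ᴿ -ᴿ y
-ᴿ-cong {x} {y} x≈y .close {ε} 0<ε = let N , p = close x≈y 0<ε in
  N , λ {n} N≤n → subst (_< ε) (sym (∣-∣-neg (seq x n) (seq y n))) (p N≤n)

*ᴿ-cong : ∀ {x y u v} → x ≈ᴿ y → u ≈ᴿ v → x *ᴿ u ≈ᴿ y *ᴿ v
*ᴿ-cong {x} {y} {u} {v} x≈y u≈v =
  let A , 0≤A , K , x≤A = eventually-bounded x
      B , 0≤B , L , v≤B = eventually-bounded v
  in ≈-up-to (0≤+ 0≤A 0≤B) λ 0<δ →
  let N , p = close x≈y 0<δ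
      M , q = close u≈v 0<δ
      NM = N ℕ.⊔ M
      KL = K ℕ.⊔ L
  in NM ℕ.⊔ KL , λ {n} ≤n →
  let NM≤n = ℕₚ.m⊔n≤o⇒m≤o NM KL ≤n
      KL≤n = ℕₚ.m⊔n≤o⇒n≤o NM KL ≤n
  in product-bound (seq x n) (seq u n) (seq y n) (seq v n) 0≤A (<⇒≤ 0<δ)
       (x≤A (ℕₚ.m⊔n≤o⇒m≤o K L KL≤n)) (v≤B (ℕₚ.m⊔n≤o⇒n≤o K L KL≤n))
       (<⇒≤ (p (ℕₚ.m⊔n≤o⇒m≤o N M NM≤n))) (<⇒≤ (q (ℕₚ.m⊔n≤o⇒n≤o N M NM≤n)))

≈ᴿ-isEquivalence : IsEquivalence _≈ᴿ_
≈ᴿ-isEquivalence = record { refl = ≈ᴿ-refl ; sym = ≈ᴿ-sym ; trans = ≈ᴿ-trans }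

ℝ-commutativeRing : CommutativeRing 0ℓ 0ℓ
ℝ-commutativeRing = record
  { Carrier = ℝ ; _≈_ = _≈ᴿ_ ; _+_ = _+ᴿ_ ; _*_ = _*ᴿ_ ; -_ = -ᴿ_ ; 0# = 0ᴿ ; 1# = 1ᴿ
  ; isCommutativeRing = record
    { isRing = record
      { +-isAbelianGroup = record
        { isGroup = record
          { isMonoid = record
            { isSemigroup = record
              { isMagma = record { isEquivalence = ≈ᴿ-isEquivalence ; ∙-cong = +ᴿ-cong }
              ; assoc = λ x y z → pointwise λ n → +-assoc (seq x n) (seq y n) (seq z n) }
            ; identity = (λ x → pointwise λ n → +-identityˡ (seq x n))
                       , (λ x → pointwise λ n → +-identityʳ (seq x n)) }
          ; inverse = (λ x → pointwise λ n → +-inverseˡ (seq x n))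
                    , (λ x → pointwise λ n → +-inverseʳ (seq x n))
          ; ⁻¹-cong = -ᴿ-cong }
        ; comm = λ x y → pointwise λ n → +-comm (seq x n) (seq y n) }
      ; *-cong = *ᴿ-cong
      ; *-assoc = λ x y z → pointwise λ n → *-assoc (seq x n) (seq y n) (seq z n)
      ; *-identity = (λ x → pointwise λ n → *-identityˡ (seq x n))
                   , (λ x → pointwise λ n → *-identityʳ (seq x n))
      ; distrib = (λ x y z → pointwise λ n → *-distribˡ-+ (seq x n) (seq y n) (seq z n))
                , (λ x y z → pointwise λ n → *-distribʳ-+ (seq x n) (seq y n) (seq z n)) }
    ; *-comm = λ x y → pointwise λ n → *-comm (seq x n) (seq y n) } }

------------------------------------------------------------------------

ℚ[i] : Set
ℚ[i] = ℚ × ℚ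

infixl 6 _⊕_ _⊖_
infixl 7 _⊗_ _•_

_⊕_ _⊖_ _⊗_ : ℚ[i] → ℚ[i] → ℚ[i]
(a , b) ⊕ (c , d) = a + c , b + d
(a , b) ⊖ (c , d) = a - c , b - d
(a , b) ⊗ (c , d) = a * c - b * d , a * d + b * c

_•_ : ℚ → ℚ[i] → ℚ[i]
r • (a , b) = r * a , r * b

-- expTerm k z = zᵏ / k!
expTerm : ℕ → ℚ[i] → ℚ[i]
expTerm zero    z = 1ℚ , 0ℚ
expTerm (suc k) z = (+ 1 / suc k) • (expTerm k z ⊗ z)

-- expSum n z = ∑ { zᵏ / k! ∣ k < n }
expSum : ℕ → ℚ[i] → ℚ[i]
expSum zero    z = 0ℚ , 0ℚ
expSum (suc n) z = expSum n z ⊕ expTerm n z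

‖_‖ : ℚ[i] → ℚ
‖ a , b ‖ = ∣ a ∣ + ∣ b ∣

module _ where
  open ≤-Reasoning

  0≤‖_‖ : ∀ z → 0ℚ ≤ ‖ z ‖
  0≤‖ a , b ‖ = 0≤+ (0≤∣p∣ a) (0≤∣p∣ b)

  ‖⊖‖-refl : ∀ z → ‖ z ⊖ z ‖ ≡ 0ℚ
  ‖⊖‖-refl (a , b) = cong ‖_‖ (cong₂ _,_ (+-inverseʳ a) (+-inverseʳ b))

  ‖⊕‖ : ∀ z w → ‖ z ⊕ w ‖ ≤ ‖ z ‖ + ‖ w ‖
  ‖⊕‖ (a , b) (c , d) = begin
    ∣ a + c ∣ + ∣ b + d ∣                    ≤⟨ +-mono-≤ (∣p+q∣≤∣p∣+∣q∣ a c) (∣p+q∣≤∣p∣+∣q∣ b d) ⟩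
    (∣ a ∣ + ∣ c ∣) + (∣ b ∣ + ∣ d ∣)        ≡⟨ solve 4 (λ a b c d → (a :+ c) :+ (b :+ d) := (a :+ b) :+ (c :+ d)) refl (∣ a ∣) (∣ b ∣) (∣ c ∣) (∣ d ∣) ⟩
    (∣ a ∣ + ∣ b ∣) + (∣ c ∣ + ∣ d ∣)        ∎

  ‖⊗‖ : ∀ z w → ‖ z ⊗ w ‖ ≤ ‖ z ‖ * ‖ w ‖
  ‖⊗‖ (a , b) (c , d) = begin
    ∣ a * c - b * d ∣ + ∣ a * d + b * c ∣
      ≤⟨ +-mono-≤ (∣p-q∣≤∣p∣+∣q∣ (a * c) (b * d)) (∣p+q∣≤∣p∣+∣q∣ (a * d) (b * c)) ⟩
    (∣ a * c ∣ + ∣ b * d ∣) + (∣ a * d ∣ + ∣ b * c ∣)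
      ≡⟨ cong₂ _+_ (cong₂ _+_ (∣p*q∣≡∣p∣*∣q∣ a c) (∣p*q∣≡∣p∣*∣q∣ b d))
                   (cong₂ _+_ (∣p*q∣≡∣p∣*∣q∣ a d) (∣p*q∣≡∣p∣*∣q∣ b c)) ⟩
    (∣ a ∣ * ∣ c ∣ + ∣ b ∣ * ∣ d ∣) + (∣ a ∣ * ∣ d ∣ + ∣ b ∣ * ∣ c ∣)
      ≡⟨ solve 4 (λ a b c d → (a :* c :+ b :* d) :+ (a :* d :+ b :* c) := (a :+ b) :* (c :+ d)) refl (∣ a ∣) (∣ b ∣) (∣ c ∣) (∣ d ∣) ⟩
    (∣ a ∣ + ∣ b ∣) * (∣ c ∣ + ∣ d ∣)        ∎

  ‖•‖ : ∀ {r} → 0ℚ ≤ r → ∀ z → ‖ r • z ‖ ≡ r * ‖ z ‖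
  ‖•‖ {r} 0≤r (a , b) = begin-equality
    ∣ r * a ∣ + ∣ r * b ∣          ≡⟨ cong₂ _+_ (∣p*q∣≡∣p∣*∣q∣ r a) (∣p*q∣≡∣p∣*∣q∣ r b) ⟩
    ∣ r ∣ * ∣ a ∣ + ∣ r ∣ * ∣ b ∣  ≡⟨ *-distribˡ-+ (∣ r ∣) (∣ a ∣) (∣ b ∣) ⟨
    ∣ r ∣ * (∣ a ∣ + ∣ b ∣)        ≡⟨ cong (_* (∣ a ∣ + ∣ b ∣)) (0≤p⇒∣p∣≡p 0≤r) ⟩
    r * (∣ a ∣ + ∣ b ∣)            ∎

  ‖⊖‖-triangle : ∀ z w u → ‖ z ⊖ u ‖ ≤ ‖ z ⊖ w ‖ + ‖ w ⊖ u ‖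
  ‖⊖‖-triangle (a , b) (c , d) (e , f) = begin
    ∣ a - e ∣ + ∣ b - f ∣
      ≤⟨ +-mono-≤ (∣-∣-triangle a c e) (∣-∣-triangle b d f) ⟩
    (∣ a - c ∣ + ∣ c - e ∣) + (∣ b - d ∣ + ∣ d - f ∣)
      ≡⟨ solve 4 (λ a b c d → (a :+ c) :+ (b :+ d) := (a :+ b) :+ (c :+ d)) refl (∣ a - c ∣) (∣ b - d ∣) (∣ c - e ∣) (∣ d - f ∣) ⟩
    (∣ a - c ∣ + ∣ b - d ∣) + (∣ c - e ∣ + ∣ d - f ∣) ∎

  ‖⊖‖-swap : ∀ z w → ‖ z ⊖ w ‖ ≡ ‖ w ⊖ z ‖
  ‖⊖‖-swap (a , b) (c , d) = cong₂ _+_ (∣-∣-swap a c) (∣-∣-swap b d)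

-- The same partial sums for a nonnegative real argument B, which dominate
-- those at any z with ‖ z ‖ ≤ B.
module Majorant {B : ℚ} (0≤B : 0ℚ ≤ B) where

  open ≤-Reasoning

  term : ℕ → ℚ
  term zero    = 1ℚ
  term (suc k) = (+ 1 / suc k) * (term k * B)

  total : ℕ → ℚ
  total zero    = 0ℚ
  total (suc n) = total n + term n

  0≤term : ∀ k → 0ℚ ≤ term k
  0≤term zero    = 0≤1ℚ
  0≤term (suc k) = 0≤* (0≤1/suc k) (0≤* (0≤term k) 0≤B)

  0≤total : ∀ n → 0ℚ ≤ total n
  0≤total zero    = ≤-refl
  0≤total (suc n) = 0≤+ (0≤total n) (0≤term n)

  total-mono : ∀ {N n} → N ℕ.≤ n → total N ≤ total n
  total-mono {N} = from {λ n → total N ≤ total n} N go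
    where
    go : ∀ j → total N ≤ total (j ℕ.+ N)
    go zero    = ≤-refl
    go (suc j) = ≤-trans (go j) (p≤p+q (0≤term (j ℕ.+ N)))

  term-ι : ∀ k → term (suc k) * ι (suc k) ≡ term k * B
  term-ι k = begin-equality
    r * (term k * B) * ι (suc k)    ≡⟨ solve 3 (λ r t i → r :* t :* i := (r :* i) :* t) refl r (term k * B) (ι (suc k)) ⟩
    r * ι (suc k) * (term k * B)    ≡⟨ cong (_* (term k * B)) (1/suc*ι k) ⟩
    1ℚ * (term k * B)               ≡⟨ *-identityˡ (term k * B) ⟩
    term k * B                      ∎
    where r = + 1 / suc k

  ‖expTerm‖≤ : ∀ z → ‖ z ‖ ≤ B → ∀ k → ‖ expTerm k z ‖ ≤ term k
  ‖expTerm‖≤ z z≤B zero    = ≤-refl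
  ‖expTerm‖≤ z z≤B (suc k) = begin
    ‖ r • (expTerm k z ⊗ z) ‖      ≡⟨ ‖•‖ (0≤1/suc k) (expTerm k z ⊗ z) ⟩
    r * ‖ expTerm k z ⊗ z ‖        ≤⟨ *-monoˡ (0≤1/suc k) (‖⊗‖ (expTerm k z) z) ⟩
    r * (‖ expTerm k z ‖ * ‖ z ‖)  ≤⟨ *-monoˡ (0≤1/suc k) (*-mono 0≤‖ z ‖ (0≤term k) (‖expTerm‖≤ z z≤B k) z≤B) ⟩
    r * (term k * B)               ∎
    where r = + 1 / suc k

  expSum-tail : ∀ z → ‖ z ‖ ≤ B → ∀ {N n} → N ℕ.≤ n →
                ‖ expSum n z ⊖ expSum N z ‖ + total N ≤ total n
  expSum-tail z z≤B {N} = from {λ n → ‖ expSum n z ⊖ expSum N z ‖ + total N ≤ total n} N go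
    where
    S : ℕ → ℚ[i]
    S n = expSum n z
    swap : ∀ u v w → (u ⊕ v) ⊖ w ≡ (u ⊖ w) ⊕ v
    swap (a , b) (c , d) (e , f) = cong₂ _,_ (eq a c e) (eq b d f)
      where eq = solve 3 (λ a c e → (a :+ c) :- e := (a :- e) :+ c) refl
    step : ∀ n → ‖ S n ⊖ S N ‖ + total N ≤ total n → ‖ S (suc n) ⊖ S N ‖ + total N ≤ total (suc n)
    step n ih = begin
      ‖ (S n ⊕ expTerm n z) ⊖ S N ‖ + total N        ≡⟨ cong (λ u → ‖ u ‖ + total N) (swap (S n) (expTerm n z) (S N)) ⟩
      ‖ (S n ⊖ S N) ⊕ expTerm n z ‖ + total N        ≤⟨ +-monoˡ-≤ (total N) (‖⊕‖ (S n ⊖ S N) (expTerm n z)) ⟩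
      ‖ S n ⊖ S N ‖ + ‖ expTerm n z ‖ + total N      ≡⟨ solve 3 (λ a b c → (a :+ b) :+ c := (a :+ c) :+ b) refl ‖ S n ⊖ S N ‖ ‖ expTerm n z ‖ (total N) ⟩
      ‖ S n ⊖ S N ‖ + total N + ‖ expTerm n z ‖      ≤⟨ +-mono-≤ ih (‖expTerm‖≤ z z≤B n) ⟩
      total n + term n                               ∎
    go : ∀ j → ‖ S (j ℕ.+ N) ⊖ S N ‖ + total N ≤ total (j ℕ.+ N)
    go zero    = ≤-reflexive (trans (cong (_+ total N) (‖⊖‖-refl (S N))) (+-identityˡ (total N)))
    go (suc j) = step (j ℕ.+ N) (go j)

  module Lipschitz (z w : ℚ[i]) (z≤B : ‖ z ‖ ≤ B) (w≤B : ‖ w ‖ ≤ B) where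

    δ = ‖ z ⊖ w ‖

    Δ : ℕ → ℚ[i]
    Δ k = expTerm k z ⊖ expTerm k w

    split : ∀ r u v → (r • (u ⊗ z)) ⊖ (r • (v ⊗ w)) ≡ r • ((u ⊗ (z ⊖ w)) ⊕ ((u ⊖ v) ⊗ w))
    split r (a , b) (c , d) = cong₂ _,_
      (solve 9 (λ r a b c d e f g h →
         r :* (a :* e :- b :* f) :- r :* (c :* g :- d :* h)
         := r :* ((a :* (e :- g) :- b :* (f :- h)) :+ ((a :- c) :* g :- (b :- d) :* h)))
       refl r a b c d (proj₁ z) (proj₂ z) (proj₁ w) (proj₂ w))
      (solve 9 (λ r a b c d e f g h →
         r :* (a :* f :+ b :* e) :- r :* (c :* h :+ d :* g)
         := r :* ((a :* (f :- h) :+ b :* (e :- g)) :+ ((a :- c) :* h :+ (b :- d) :* g)))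
       refl r a b c d (proj₁ z) (proj₂ z) (proj₁ w) (proj₂ w))

    mutual
      ‖Δ‖≤ : ∀ k → ‖ Δ (suc k) ‖ ≤ δ * term k
      ‖Δ‖≤ k = begin
        ‖ Δ (suc k) ‖                          ≡⟨ cong ‖_‖ (split r t (expTerm k w)) ⟩
        ‖ r • ((t ⊗ (z ⊖ w)) ⊕ (Δ k ⊗ w)) ‖    ≡⟨ ‖•‖ (0≤1/suc k) ((t ⊗ (z ⊖ w)) ⊕ (Δ k ⊗ w)) ⟩
        r * ‖ (t ⊗ (z ⊖ w)) ⊕ (Δ k ⊗ w) ‖      ≤⟨ *-monoˡ (0≤1/suc k) (begin
          ‖ (t ⊗ (z ⊖ w)) ⊕ (Δ k ⊗ w) ‖          ≤⟨ ‖⊕‖ (t ⊗ (z ⊖ w)) (Δ k ⊗ w) ⟩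
          ‖ t ⊗ (z ⊖ w) ‖ + ‖ Δ k ⊗ w ‖          ≤⟨ +-mono-≤ (‖⊗‖ t (z ⊖ w)) (‖⊗‖ (Δ k) w) ⟩
          ‖ t ‖ * δ + ‖ Δ k ‖ * ‖ w ‖            ≤⟨ +-mono-≤ (*-monoʳ 0≤‖ z ⊖ w ‖ (‖expTerm‖≤ z z≤B k)) (*-monoˡ 0≤‖ Δ k ‖ w≤B) ⟩
          term k * δ + ‖ Δ k ‖ * B               ≤⟨ +-monoʳ-≤ (term k * δ) (‖Δ‖B≤ k) ⟩
          term k * δ + δ * (term k * ι k)        ∎) ⟩
        r * (term k * δ + δ * (term k * ι k))  ≡⟨ solve 4 (λ r t d i → r :* (t :* d :+ d :* (t :* i)) := (r :* (con 1ℚ :+ i)) :* (d :* t)) refl r (term k) δ (ι k) ⟩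
        r * (1ℚ + ι k) * (δ * term k)          ≡⟨ cong (λ i → r * i * (δ * term k)) (sym (ι-suc k)) ⟩
        r * ι (suc k) * (δ * term k)           ≡⟨ cong (_* (δ * term k)) (1/suc*ι k) ⟩
        1ℚ * (δ * term k)                      ≡⟨ *-identityˡ (δ * term k) ⟩
        δ * term k                             ∎
        where
        r = + 1 / suc k
        t = expTerm k z

      ‖Δ‖B≤ : ∀ k → ‖ Δ k ‖ * B ≤ δ * (term k * ι k)
      ‖Δ‖B≤ zero    = ≤-reflexive (trans (*-zeroˡ B) (sym (*-zeroʳ δ)))
      ‖Δ‖B≤ (suc k) = begin
        ‖ Δ (suc k) ‖ * B                 ≤⟨ *-monoʳ 0≤B (‖Δ‖≤ k) ⟩
        δ * term k * B                    ≡⟨ *-assoc δ (term k) B ⟩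
        δ * (term k * B)                  ≡⟨ cong (δ *_) (sym (term-ι k)) ⟩
        δ * (term (suc k) * ι (suc k))    ∎

    regroup : ∀ u v u′ v′ → (u ⊕ v) ⊖ (u′ ⊕ v′) ≡ (u ⊖ u′) ⊕ (v ⊖ v′)
    regroup (a , b) (c , d) (e , f) (g , h) = cong₂ _,_ (eq a c e g) (eq b d f h)
      where eq = solve 4 (λ a c e g → (a :+ c) :- (e :+ g) := (a :- e) :+ (c :- g)) refl

    expSum-lipschitz : ∀ n → ‖ expSum n z ⊖ expSum n w ‖ ≤ δ * total n
    expSum-lipschitz zero    = ≤-reflexive (sym (*-zeroʳ δ))
    expSum-lipschitz (suc n) = ≤-trans (go n) (*-monoˡ 0≤‖ z ⊖ w ‖ (p≤p+q (0≤term n)))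
      where
      go : ∀ n → ‖ expSum (suc n) z ⊖ expSum (suc n) w ‖ ≤ δ * total n
      go zero    = ≤-reflexive (sym (*-zeroʳ δ))
      go (suc n) = begin
        ‖ (expSum (suc n) z ⊕ expTerm (suc n) z) ⊖ (expSum (suc n) w ⊕ expTerm (suc n) w) ‖
          ≡⟨ cong ‖_‖ (regroup (expSum (suc n) z) (expTerm (suc n) z) (expSum (suc n) w) (expTerm (suc n) w)) ⟩
        ‖ (expSum (suc n) z ⊖ expSum (suc n) w) ⊕ Δ (suc n) ‖
          ≤⟨ ‖⊕‖ (expSum (suc n) z ⊖ expSum (suc n) w) (Δ (suc n)) ⟩
        ‖ expSum (suc n) z ⊖ expSum (suc n) w ‖ + ‖ Δ (suc n) ‖
          ≤⟨ +-mono-≤ (go n) (‖Δ‖≤ n) ⟩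
        δ * total n + δ * term n
          ≡⟨ *-distribˡ-+ δ (total n) (term n) ⟨
        δ * (total n + term n) ∎

  open Lipschitz public using (expSum-lipschitz)

  -- From index K on, each term is at most half of the previous one.
  K : ℕ
  K = proj₁ (≤ι (B * 2ℚ))

  halving : ∀ {k} → K ℕ.≤ k → 2ℚ * term (suc k) ≤ term k
  halving {k} K≤k = begin
    2ℚ * (r * (term k * B))        ≡⟨ solve 4 (λ c r t b → c :* (r :* (t :* b)) := (r :* t) :* (b :* c)) refl 2ℚ r (term k) B ⟩
    r * term k * (B * 2ℚ)          ≤⟨ *-monoˡ (0≤* (0≤1/suc k) (0≤term k)) (≤-trans (proj₂ (≤ι (B * 2ℚ))) (ι-mono (ℕₚ.m≤n⇒m≤1+n K≤k))) ⟩
    r * term k * ι (suc k)         ≡⟨ solve 3 (λ r t i → r :* t :* i := (r :* i) :* t) refl r (term k) (ι (suc k)) ⟩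
    r * ι (suc k) * term k         ≡⟨ cong (_* term k) (1/suc*ι k) ⟩
    1ℚ * term k                    ≡⟨ *-identityˡ (term k) ⟩
    term k                         ∎
    where r = + 1 / suc k

  total-tail : ∀ {N n} → K ℕ.≤ N → N ℕ.≤ n → total n ≤ total N + 2ℚ * term N
  total-tail {N} {m} K≤N N≤m = ≤-trans (p≤p+q (0≤* (nonNegative⁻¹ 2ℚ) (0≤term m)))
    (from {λ n → total n + 2ℚ * term n ≤ total N + 2ℚ * term N} N go N≤m)
    where
    go : ∀ j → total (j ℕ.+ N) + 2ℚ * term (j ℕ.+ N) ≤ total N + 2ℚ * term N
    go zero    = ≤-refl
    go (suc j) = begin
      total n + term n + 2ℚ * term (suc n)   ≤⟨ +-monoʳ-≤ (total n + term n) (halving (ℕₚ.≤-trans K≤N (ℕₚ.m≤n+m N j))) ⟩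
      total n + term n + term n              ≡⟨ +-assoc (total n) (term n) (term n) ⟩
      total n + (term n + term n)            ≡⟨ cong (λ t → total n + t) (2* (term n)) ⟩
      total n + 2ℚ * term n                  ≤⟨ go j ⟩
      total N + 2ℚ * term N                  ∎
      where n = j ℕ.+ N

  bound : ℚ
  bound = total K + 2ℚ * term K

  0≤bound : 0ℚ ≤ bound
  0≤bound = 0≤+ (0≤total K) (0≤* (nonNegative⁻¹ 2ℚ) (0≤term K))

  total≤bound : ∀ n → total n ≤ bound
  total≤bound n = ≤-trans (total-mono (ℕₚ.m≤m⊔n n K)) (total-tail ℕₚ.≤-refl (ℕₚ.m≤n⊔m n K))

  term≤bound : ∀ k → term k ≤ bound
  term≤bound k = ≤-trans (p≤q+p (0≤total k)) (total≤bound (suc k))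

  tail-small : ∀ {δ} → 0ℚ < δ → ∃ λ N → ∀ z → ‖ z ‖ ≤ B → ∀ {n} → N ℕ.≤ n →
               ‖ expSum n z ⊖ expSum N z ‖ ≤ 2ℚ * (bound * B) * δ
  tail-small {δ} 0<δ = N , λ z z≤B {n} N≤n → +-cancelʳ-≤ (total N) (begin
    ‖ expSum n z ⊖ expSum N z ‖ + total N     ≤⟨ expSum-tail z z≤B N≤n ⟩
    total n                                   ≤⟨ total-tail (ℕₚ.m≤n⇒m≤1+n (ℕₚ.m≤n⊔m A K)) N≤n ⟩
    total N + 2ℚ * term N                     ≤⟨ +-monoʳ-≤ (total N) (*-monoˡ (nonNegative⁻¹ 2ℚ) term-N) ⟩
    total N + 2ℚ * (bound * B * δ)            ≡⟨ solve 4 (λ t c b d → t :+ c :* (b :* d) := (c :* b) :* d :+ t) refl (total N) 2ℚ (bound * B) δ ⟩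
    2ℚ * (bound * B) * δ + total N            ∎)
    where
    A = proj₁ (archimedean 0<δ)
    M = A ℕ.⊔ K
    N = suc M
    term-N : term N ≤ bound * B * δ
    term-N = begin
      term N                   ≡⟨ *-identityʳ (term N) ⟨
      term N * 1ℚ              ≤⟨ *-monoˡ (0≤term N) (proj₂ (archimedean 0<δ) (ℕₚ.m≤n⇒m≤1+n (ℕₚ.m≤m⊔n A K))) ⟩
      term N * (ι N * δ)       ≡⟨ *-assoc (term N) (ι N) δ ⟨
      term N * ι N * δ         ≡⟨ cong (_* δ) (term-ι M) ⟩
      term M * B * δ           ≤⟨ *-monoʳ (<⇒≤ 0<δ) (*-monoʳ 0≤B (term≤bound M)) ⟩
      bound * B * δ            ∎
    +-cancelʳ-≤ : ∀ r {p q} → p + r ≤ q + r → p ≤ q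
    +-cancelʳ-≤ r {p} {q} p+r≤q+r = subst₂ _≤_ (eq p r) (eq q r) (+-monoˡ-≤ (- r) p+r≤q+r)
      where eq = solve 2 (λ p r → (p :+ r) :+ (:- r) := p) refl

  closeness : ℚ
  closeness = 2ℚ * (bound * B) + 2ℚ * bound + 2ℚ * (bound * B)

  0≤closeness : 0ℚ ≤ closeness
  0≤closeness = 0≤+ (0≤+ 0≤MB (0≤* (nonNegative⁻¹ 2ℚ) 0≤bound)) 0≤MB
    where 0≤MB = 0≤* (nonNegative⁻¹ 2ℚ) (0≤* 0≤bound 0≤B)

  expSum-close : ∀ {δ} → 0ℚ < δ → ∃ λ N → ∀ z w → ‖ z ‖ ≤ B → ‖ w ‖ ≤ B → ‖ z ⊖ w ‖ ≤ 2ℚ * δ →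
                 ∀ {m n} → N ℕ.≤ m → N ℕ.≤ n → ‖ expSum m z ⊖ expSum n w ‖ ≤ closeness * δ
  expSum-close {δ} 0<δ = N , λ z w z≤B w≤B z-w {m} {n} N≤m N≤n → begin
    ‖ expSum m z ⊖ expSum n w ‖
      ≤⟨ ‖⊖‖-triangle (expSum m z) (expSum N w) (expSum n w) ⟩
    ‖ expSum m z ⊖ expSum N w ‖ + ‖ expSum N w ⊖ expSum n w ‖
      ≤⟨ +-monoˡ-≤ ‖ expSum N w ⊖ expSum n w ‖ (‖⊖‖-triangle (expSum m z) (expSum N z) (expSum N w)) ⟩
    ‖ expSum m z ⊖ expSum N z ‖ + ‖ expSum N z ⊖ expSum N w ‖ + ‖ expSum N w ⊖ expSum n w ‖
      ≤⟨ +-mono-≤ (+-mono-≤ (small z z≤B N≤m)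
           (≤-trans (expSum-lipschitz z w z≤B w≤B N)
                    (*-mono (0≤total N) (0≤* (nonNegative⁻¹ 2ℚ) (<⇒≤ 0<δ)) z-w (total≤bound N))))
           (≤-trans (≤-reflexive (‖⊖‖-swap (expSum N w) (expSum n w))) (small w w≤B N≤n)) ⟩
    2ℚ * (bound * B) * δ + 2ℚ * δ * bound + 2ℚ * (bound * B) * δ
      ≡⟨ solve 4 (λ c m b d → c :* (m :* b) :* d :+ c :* d :* m :+ c :* (m :* b) :* d
                             := (c :* (m :* b) :+ c :* m :+ c :* (m :* b)) :* d) refl 2ℚ bound B δ ⟩
    closeness * δ ∎
    where
    N = proj₁ (tail-small 0<δ)
    small = proj₂ (tail-small 0<δ)

------------------------------------------------------------------------

record ℂ : Set where
  no-eta-equality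
  field
    re im : ℝ

open ℂ public

infix 4 _≈ᶜ_
record _≈ᶜ_ (z w : ℂ) : Set where
  no-eta-equality
  field
    re≈ : re z ≈ᴿ re w
    im≈ : im z ≈ᴿ im w

open _≈ᶜ_ public

infixl 6 _+ᶜ_ _-ᶜ_
infixl 7 _*ᶜ_
infix  8 -ᶜ_

_+ᶜ_ _*ᶜ_ : ℂ → ℂ → ℂ
(z +ᶜ w) .re = re z +ᴿ re w
(z +ᶜ w) .im = im z +ᴿ im w
(z *ᶜ w) .re = re z *ᴿ re w +ᴿ -ᴿ (im z *ᴿ im w)
(z *ᶜ w) .im = re z *ᴿ im w +ᴿ im z *ᴿ re w

-ᶜ_ : ℂ → ℂ
(-ᶜ z) .re = -ᴿ re z
(-ᶜ z) .im = -ᴿ im z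

_-ᶜ_ : ℂ → ℂ → ℂ
z -ᶜ w = z +ᶜ -ᶜ w

fromℝ : ℝ → ℂ
fromℝ x .re = x
fromℝ x .im = 0ᴿ

0ᶜ 1ᶜ 𝕚 : ℂ
0ᶜ = fromℝ 0ᴿ
1ᶜ = fromℝ 1ᴿ
𝕚 .re = 0ᴿ
𝕚 .im = 1ᴿ

≈ᶜ-isEquivalence : IsEquivalence _≈ᶜ_
≈ᶜ-isEquivalence = record
  { refl  = record { re≈ = ≈ᴿ-refl ; im≈ = ≈ᴿ-refl }
  ; sym   = λ p → record { re≈ = ≈ᴿ-sym (re≈ p) ; im≈ = ≈ᴿ-sym (im≈ p) }
  ; trans = λ p q → record { re≈ = ≈ᴿ-trans (re≈ p) (re≈ q) ; im≈ = ≈ᴿ-trans (im≈ p) (im≈ q) } }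

infix 9 _at_
_at_ : ℂ → ℕ → ℚ[i]
z at n = seq (re z) n , seq (im z) n

pointwiseᶜ : ∀ {z w} → (∀ n → z at n ≡ w at n) → z ≈ᶜ w
pointwiseᶜ eq .re≈ = pointwise λ n → cong proj₁ (eq n)
pointwiseᶜ eq .im≈ = pointwise λ n → cong proj₂ (eq n)

+ᶜ-cong : ∀ {z w u v} → z ≈ᶜ w → u ≈ᶜ v → z +ᶜ u ≈ᶜ w +ᶜ v
+ᶜ-cong p q .re≈ = +ᴿ-cong (re≈ p) (re≈ q)
+ᶜ-cong p q .im≈ = +ᴿ-cong (im≈ p) (im≈ q)

-ᶜ-cong : ∀ {z w} → z ≈ᶜ w → -ᶜ z ≈ᶜ -ᶜ w
-ᶜ-cong p .re≈ = -ᴿ-cong (re≈ p)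
-ᶜ-cong p .im≈ = -ᴿ-cong (im≈ p)

*ᶜ-cong : ∀ {z w u v} → z ≈ᶜ w → u ≈ᶜ v → z *ᶜ u ≈ᶜ w *ᶜ v
*ᶜ-cong p q .re≈ = +ᴿ-cong (*ᴿ-cong (re≈ p) (re≈ q)) (-ᴿ-cong (*ᴿ-cong (im≈ p) (im≈ q)))
*ᶜ-cong p q .im≈ = +ᴿ-cong (*ᴿ-cong (re≈ p) (im≈ q)) (*ᴿ-cong (im≈ p) (re≈ q))

⊗-assoc : ∀ u v w → (u ⊗ v) ⊗ w ≡ u ⊗ (v ⊗ w)
⊗-assoc (a , b) (c , d) (e , f) = cong₂ _,_
  (solve 6 (λ a b c d e f → (a :* c :- b :* d) :* e :- (a :* d :+ b :* c) :* f
                          := a :* (c :* e :- d :* f) :- b :* (c :* f :+ d :* e)) refl a b c d e f)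
  (solve 6 (λ a b c d e f → (a :* c :- b :* d) :* f :+ (a :* d :+ b :* c) :* e
                          := a :* (c :* f :+ d :* e) :+ b :* (c :* e :- d :* f)) refl a b c d e f)

⊗-comm : ∀ u v → u ⊗ v ≡ v ⊗ u
⊗-comm (a , b) (c , d) = cong₂ _,_
  (solve 4 (λ a b c d → a :* c :- b :* d := c :* a :- d :* b) refl a b c d)
  (solve 4 (λ a b c d → a :* d :+ b :* c := c :* b :+ d :* a) refl a b c d)

⊗-identityˡ : ∀ u → (1ℚ , 0ℚ) ⊗ u ≡ u
⊗-identityˡ (a , b) = cong₂ _,_
  (solve 2 (λ a b → con 1ℚ :* a :- con 0ℚ :* b := a) refl a b)
  (solve 2 (λ a b → con 1ℚ :* b :+ con 0ℚ :* a := b) refl a b)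

⊗-distribˡ-⊕ : ∀ u v w → u ⊗ (v ⊕ w) ≡ u ⊗ v ⊕ u ⊗ w
⊗-distribˡ-⊕ (a , b) (c , d) (e , f) = cong₂ _,_
  (solve 6 (λ a b c d e f → a :* (c :+ e) :- b :* (d :+ f) := (a :* c :- b :* d) :+ (a :* e :- b :* f)) refl a b c d e f)
  (solve 6 (λ a b c d e f → a :* (d :+ f) :+ b :* (c :+ e) := (a :* d :+ b :* c) :+ (a :* f :+ b :* e)) refl a b c d e f)

ℂ-commutativeRing : CommutativeRing 0ℓ 0ℓ
ℂ-commutativeRing = record
  { Carrier = ℂ ; _≈_ = _≈ᶜ_ ; _+_ = _+ᶜ_ ; _*_ = _*ᶜ_ ; -_ = -ᶜ_ ; 0# = 0ᶜ ; 1# = 1ᶜ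
  ; isCommutativeRing = record
    { isRing = record
      { +-isAbelianGroup = record
        { isGroup = record
          { isMonoid = record
            { isSemigroup = record
              { isMagma = record { isEquivalence = ≈ᶜ-isEquivalence ; ∙-cong = +ᶜ-cong }
              ; assoc = λ u v w → record { re≈ = R.+-assoc (re u) (re v) (re w) ; im≈ = R.+-assoc (im u) (im v) (im w) } }
            ; identity = (λ u → record { re≈ = R.+-identityˡ (re u) ; im≈ = R.+-identityˡ (im u) })
                       , (λ u → record { re≈ = R.+-identityʳ (re u) ; im≈ = R.+-identityʳ (im u) }) }
          ; inverse = (λ u → record { re≈ = R.-‿inverseˡ (re u) ; im≈ = R.-‿inverseˡ (im u) })
                    , (λ u → record { re≈ = R.-‿inverseʳ (re u) ; im≈ = R.-‿inverseʳ (im u) })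
          ; ⁻¹-cong = -ᶜ-cong }
        ; comm = λ u v → record { re≈ = R.+-comm (re u) (re v) ; im≈ = R.+-comm (im u) (im v) } }
      ; *-cong = *ᶜ-cong
      ; *-assoc = λ u v w → pointwiseᶜ λ n → ⊗-assoc (u at n) (v at n) (w at n)
      ; *-identity = (λ u → pointwiseᶜ λ n → ⊗-identityˡ (u at n))
                   , (λ u → pointwiseᶜ λ n → trans (⊗-comm (u at n) (1ℚ , 0ℚ)) (⊗-identityˡ (u at n)))
      ; distrib = (λ u v w → pointwiseᶜ λ n → ⊗-distribˡ-⊕ (u at n) (v at n) (w at n))
                , (λ u v w → pointwiseᶜ λ n →
                    trans (⊗-comm ((v at n) ⊕ (w at n)) (u at n))
                   (trans (⊗-distribˡ-⊕ (u at n) (v at n) (w at n))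
                          (cong₂ _⊕_ (⊗-comm (u at n) (v at n)) (⊗-comm (u at n) (w at n))))) }
    ; *-comm = λ u v → pointwiseᶜ λ n → ⊗-comm (u at n) (v at n) } }
  where module R = CommutativeRing ℝ-commutativeRing

module ℝR = CommutativeRing ℝ-commutativeRing
module ℂR = CommutativeRing ℂ-commutativeRing

≤‖‖ˡ : ∀ z → ∣ proj₁ z ∣ ≤ ‖ z ‖
≤‖‖ˡ (a , b) = p≤p+q (0≤∣p∣ b)

≤‖‖ʳ : ∀ z → ∣ proj₂ z ∣ ≤ ‖ z ‖
≤‖‖ʳ (a , b) = p≤q+p (0≤∣p∣ a)

eventually-boundedᶜ : ∀ z → ∃ λ B → 0ℚ ≤ B × ∃ λ N → ∀ {n} → N ℕ.≤ n → ‖ z at n ‖ ≤ B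
eventually-boundedᶜ z =
  let A , 0≤A , N , re≤A = eventually-bounded (re z)
      B , 0≤B , M , im≤B = eventually-bounded (im z)
  in A + B , 0≤+ 0≤A 0≤B , N ℕ.⊔ M , λ ≤n →
     +-mono-≤ (re≤A (ℕₚ.m⊔n≤o⇒m≤o N M ≤n)) (im≤B (ℕₚ.m⊔n≤o⇒n≤o N M ≤n))

expSum-cauchy : ∀ z → ∃ λ C → 0ℚ ≤ C × (∀ {δ} → 0ℚ < δ → ∃ λ N → ∀ {m n} → N ℕ.≤ m → N ℕ.≤ n →
                ‖ expSum m (z at m) ⊖ expSum n (z at n) ‖ ≤ C * δ)
expSum-cauchy z =
  let B , 0≤B , K , z≤B = eventually-boundedᶜ z
      module M = Majorant 0≤B
  in M.closeness , M.0≤closeness , λ {δ} 0<δ →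
  let N , close-N = M.expSum-close 0<δ
      P , p = cauchy (re z) 0<δ
      Q , q = cauchy (im z) 0<δ
      NK = N ℕ.⊔ K
      PQ = P ℕ.⊔ Q
  in NK ℕ.⊔ PQ , λ {m} {n} ≤m ≤n →
  let NK≤m = ℕₚ.m⊔n≤o⇒m≤o NK PQ ≤m
      NK≤n = ℕₚ.m⊔n≤o⇒m≤o NK PQ ≤n
      PQ≤m = ℕₚ.m⊔n≤o⇒n≤o NK PQ ≤m
      PQ≤n = ℕₚ.m⊔n≤o⇒n≤o NK PQ ≤n
  in close-N (z at m) (z at n) (z≤B (ℕₚ.m⊔n≤o⇒n≤o N K NK≤m)) (z≤B (ℕₚ.m⊔n≤o⇒n≤o N K NK≤n))
       (≤-trans (+-mono-≤ (<⇒≤ (p (ℕₚ.m⊔n≤o⇒m≤o P Q PQ≤m) (ℕₚ.m⊔n≤o⇒m≤o P Q PQ≤n)))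
                          (<⇒≤ (q (ℕₚ.m⊔n≤o⇒n≤o P Q PQ≤m) (ℕₚ.m⊔n≤o⇒n≤o P Q PQ≤n))))
                (≤-reflexive (2* δ)))
       (ℕₚ.m⊔n≤o⇒m≤o N K NK≤m) (ℕₚ.m⊔n≤o⇒m≤o N K NK≤n)

exp-cong-bound : ∀ {z w} → z ≈ᶜ w → ∃ λ C → 0ℚ ≤ C × (∀ {δ} → 0ℚ < δ → ∃ λ N → ∀ {n} → N ℕ.≤ n →
                 ‖ expSum n (z at n) ⊖ expSum n (w at n) ‖ ≤ C * δ)
exp-cong-bound {z} {w} z≈w =
  let A , 0≤A , K , z≤A = eventually-boundedᶜ z
      B , 0≤B , L , w≤B = eventually-boundedᶜ w
      module M = Majorant (0≤+ 0≤A 0≤B)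
  in M.closeness , M.0≤closeness , λ {δ} 0<δ →
  let N , close-N = M.expSum-close 0<δ
      P , p = close (re≈ z≈w) 0<δ
      Q , q = close (im≈ z≈w) 0<δ
      KL = K ℕ.⊔ L
      PQ = P ℕ.⊔ Q
      KLPQ = KL ℕ.⊔ PQ
  in N ℕ.⊔ KLPQ , λ {n} ≤n →
  let N≤n = ℕₚ.m⊔n≤o⇒m≤o N KLPQ ≤n
      KLPQ≤n = ℕₚ.m⊔n≤o⇒n≤o N KLPQ ≤n
      KL≤n = ℕₚ.m⊔n≤o⇒m≤o KL PQ KLPQ≤n
      PQ≤n = ℕₚ.m⊔n≤o⇒n≤o KL PQ KLPQ≤n
  in close-N (z at n) (w at n)
       (≤-trans (z≤A (ℕₚ.m⊔n≤o⇒m≤o K L KL≤n)) (p≤p+q 0≤B))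
       (≤-trans (w≤B (ℕₚ.m⊔n≤o⇒n≤o K L KL≤n)) (p≤q+p 0≤A))
       (≤-trans (+-mono-≤ (<⇒≤ (p (ℕₚ.m⊔n≤o⇒m≤o P Q PQ≤n))) (<⇒≤ (q (ℕₚ.m⊔n≤o⇒n≤o P Q PQ≤n))))
                (≤-reflexive (2* δ)))
       N≤n N≤n

-- The series is truncated after n terms and its argument is approximated by
-- z at n simultaneously; both errors tend to zero.
exp : ℂ → ℂ
exp z .re .seq n = proj₁ (expSum n (z at n))
exp z .im .seq n = proj₂ (expSum n (z at n))
exp z .re .cauchy = let C , 0≤C , est = expSum-cauchy z in
  cauchy-up-to (λ n → proj₁ (expSum n (z at n))) 0≤C λ 0<δ → let N , bnd = est 0<δ in
  N , λ {m} {n} N≤m N≤n → ≤-trans (≤‖‖ˡ (expSum m (z at m) ⊖ expSum n (z at n))) (bnd N≤m N≤n)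
exp z .im .cauchy = let C , 0≤C , est = expSum-cauchy z in
  cauchy-up-to (λ n → proj₂ (expSum n (z at n))) 0≤C λ 0<δ → let N , bnd = est 0<δ in
  N , λ {m} {n} N≤m N≤n → ≤-trans (≤‖‖ʳ (expSum m (z at m) ⊖ expSum n (z at n))) (bnd N≤m N≤n)

exp-cong : ∀ {z w} → z ≈ᶜ w → exp z ≈ᶜ exp w
exp-cong {z} {w} z≈w .re≈ = let C , 0≤C , est = exp-cong-bound z≈w in
  ≈-up-to 0≤C λ 0<δ → let N , bnd = est 0<δ in
  N , λ {n} N≤n → ≤-trans (≤‖‖ˡ (expSum n (z at n) ⊖ expSum n (w at n))) (bnd N≤n)
exp-cong {z} {w} z≈w .im≈ = let C , 0≤C , est = exp-cong-bound z≈w in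
  ≈-up-to 0≤C λ 0<δ → let N , bnd = est 0<δ in
  N , λ {n} N≤n → ≤-trans (≤‖‖ʳ (expSum n (z at n) ⊖ expSum n (w at n))) (bnd N≤n)

e^𝕚_ : ℝ → ℂ
e^𝕚 x = exp (𝕚 *ᶜ fromℝ x)

e^𝕚-cong : ∀ {x y} → x ≈ᴿ y → e^𝕚 x ≈ᶜ e^𝕚 y
e^𝕚-cong x≈y = exp-cong (*ᶜ-cong ℂR.refl record { re≈ = x≈y ; im≈ = ≈ᴿ-refl })

------------------------------------------------------------------------

-- Edge is a mere relation, so that a function on edges is a function on a
-- subset of Vertex × Vertex.
record Graph (v e : Level) : Set (lsuc (v ⊔ˡ e)) where
  field
    Vertex          : Set v
    countable       : Vertex ↣ ℕ
    Edge            : Rel Vertex e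
    edge-irrelevant : Irrelevant Edge
    edge-sym        : Symmetric Edge
    loopless        : Irreflexive _≡_ Edge
    connected       : Universal (Star Edge)
    locally-finite  : ∀ x → ∃ λ n → (∃ λ y → Edge x y) ↔ Fin n

-- Skew-symmetric functions on the edges with values in R, of which only the
-- additive group is used.
record Skew {v e c ℓ} (G : Graph v e) (R : CommutativeRing c ℓ) : Set (v ⊔ˡ e ⊔ˡ c ⊔ˡ ℓ) where
  open Graph G
  open CommutativeRing R using (Carrier; _≈_) renaming (-_ to minus)
  field
    val  : ∀ x y → Edge x y → Carrier
    skew : ∀ x y (xy : Edge x y) → val x y xy ≈ minus (val y x (edge-sym xy))

open Skew public

record MagneticGraph (v e : Level) : Set (lsuc (v ⊔ˡ e)) where
  field
    graph : Graph v e
    α     : Skew graph ℝ-commutativeRing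

  open Graph graph public

-- gauge⁰ f and gauge¹ f are the change of gauge by f on functions of the
-- vertices and on skew-symmetric functions of the edges.
gauge⁰ : ∀ {v} {V : Set v} → (V → ℝ) → (V → ℂ) → (V → ℂ)
gauge⁰ f g x = e^𝕚 (f x) *ᶜ g x

module _ {v e : Level} {G : Graph v e} where

  open Graph G

  module _ {c ℓ : Level} {R : CommutativeRing c ℓ} where

    private
      module R = CommutativeRing R
    open import Algebra.Properties.AbelianGroup R.+-abelianGroup using (⁻¹-anti-homo-//; ⁻¹-∙-comm)

    infix 4 _≈ˢ_
    _≈ˢ_ : Skew G R → Skew G R → Set (v ⊔ˡ e ⊔ˡ ℓ)
    φ ≈ˢ ψ = ∀ x y (xy : Edge x y) → val φ x y xy R.≈ val ψ x y xy

    infixl 6 _+ˢ_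
    _+ˢ_ : Skew G R → Skew G R → Skew G R
    (φ +ˢ ψ) .val x y xy = val φ x y xy R.+ val ψ x y xy
    (φ +ˢ ψ) .skew x y xy = R.trans (R.+-cong (skew φ x y xy) (skew ψ x y xy))
      (⁻¹-∙-comm (val φ y x (edge-sym xy)) (val ψ y x (edge-sym xy)))

    d⁰ : (Vertex → R.Carrier) → Skew G R
    d⁰ f .val x y _ = f y R.- f x
    d⁰ f .skew x y _ = R.sym (⁻¹-anti-homo-// (f x) (f y))

  -- d⁰[ a ] is the difference magnetic operator of the potential a; edge-sym xy
  -- is the edge (y , x).
  d⁰[_] : Skew G ℝ-commutativeRing → (Vertex → ℂ) → Skew G ℂ-commutativeRing
  d⁰[ a ] g .val x y xy =
    e^𝕚 (val a y x (edge-sym xy) /2) *ᶜ g y -ᶜ e^𝕚 (val a x y xy /2) *ᶜ g x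
  d⁰[ a ] g .skew x y xy
    rewrite edge-irrelevant (edge-sym (edge-sym xy)) xy =
    ℂR.sym (⁻¹-anti-homo-// (e^𝕚 (val a x y xy /2) *ᶜ g x) (e^𝕚 (val a y x (edge-sym xy) /2) *ᶜ g y))
    where open import Algebra.Properties.AbelianGroup ℂR.+-abelianGroup using (⁻¹-anti-homo-//)

  gauge¹ : (Vertex → ℝ) → Skew G ℂ-commutativeRing → Skew G ℂ-commutativeRing
  gauge¹ f φ .val x y xy = e^𝕚 ((f x +ᴿ f y) /2) *ᶜ val φ x y xy
  gauge¹ f φ .skew x y xy = ℂR.trans
    (*ᶜ-cong (e^𝕚-cong (*ᴿ-cong ≈ᴿ-refl (ℝR.+-comm (f x) (f y)))) (skew φ x y xy))
    (ℂR.sym (-‿distribʳ-* (e^𝕚 ((f y +ᴿ f x) /2)) (val φ y x (edge-sym xy))))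
    where open import Algebra.Properties.Ring ℂR.ring using (-‿distribʳ-*)

{-# OPTIONS --safe #-}
module Submission where

-- Gauge invariance reduces to e^{i(x + y)} = e^{ix} e^{iy}: the two exponents
-- (α(y,x) + f(x) − f(y))/2 + f(y) and (f(x) + f(y))/2 + α(y,x)/2 agree. The
-- functional equation of exp is a Cauchy product. Both partial sums are
-- truncated at n, so ∑_{j<n} a_j ∑_{k<n} b_k exceeds ∑_{m<n} ∑_{j+k=m} a_j b_k
-- by ∑_{j<n} a_j (B_n − B_{n−j}) with B_k the partial sums of b. For j ≤ n − N
-- the bracket is small; for the remaining j it is bounded, and the sum of the
-- ‖ a_j ‖ is small.

open import Defs
open import Level using (Level; 0ℓ)
open import Algebra.Bundles using (CommutativeRing)
open import Data.Integer.Base using (+_)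
open import Data.Nat.Base as ℕ using (ℕ; zero; suc)
import Data.Nat.Properties as ℕₚ
open import Data.Product.Base using (∃; _,_; proj₁; proj₂)
open import Data.Sum.Base using (inj₁; inj₂)
open import Relation.Binary.PropositionalEquality
  using (_≡_; refl; sym; trans; cong; cong₂; subst; subst₂; isEquivalence; module ≡-Reasoning)
import Relation.Binary.Reasoning.Setoid as SetoidReasoning

-- Convolutions, formal derivatives and partial sums over a commutative ring.

module Convolution {c ℓ : Level} (R : CommutativeRing c ℓ) where

  open CommutativeRing R renaming (refl to ≈-refl; sym to ≈-sym; trans to ≈-trans)
  open import Algebra.Definitions.RawMonoid +-rawMonoid using ()
    renaming (_×_ to _·_)
  open import Algebra.Properties.CommutativeMonoid.Mult +-commutativeMonoid using ()
    renaming (×-distrib-+ to ·-distrib-+)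
  open import Algebra.Properties.Semiring.Mult semiring using ()
    renaming (×-comm-* to ·-comm-*)
  open SetoidReasoning setoid
  open import Algebra.Properties.AbelianGroup +-abelianGroup using (⁻¹-∙-comm)
  open import Algebra.Properties.Ring ring using (-‿distribʳ-*)
  open import Algebra.Solver.Ring.NaturalCoefficients.Default commutativeSemiring
    using (solve; con; _:=_; _:+_; _:*_)

  psum : (ℕ → Carrier) → ℕ → Carrier
  psum a zero    = 0#
  psum a (suc n) = psum a n + a n

  -- conv a b n = ∑ { a i * b j ∣ i + j = n }
  conv : (ℕ → Carrier) → (ℕ → Carrier) → ℕ → Carrier
  conv a b zero    = a 0 * b 0
  conv a b (suc n) = a 0 * b (suc n) + conv (λ i → a (suc i)) b n

  -- The coefficients of the derivative of the power series with coefficients a.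
  D : (ℕ → Carrier) → ℕ → Carrier
  D a n = suc n · a (suc n)

  conv-cong : ∀ {a a′ b b′} → (∀ i → a i ≈ a′ i) → (∀ i → b i ≈ b′ i) → ∀ n → conv a b n ≈ conv a′ b′ n
  conv-cong a≈ b≈ zero    = *-cong (a≈ 0) (b≈ 0)
  conv-cong a≈ b≈ (suc n) = +-cong (*-cong (a≈ 0) (b≈ (suc n))) (conv-cong (λ i → a≈ (suc i)) b≈ n)

  conv-+ˡ : ∀ a a′ b n → conv (λ i → a i + a′ i) b n ≈ conv a b n + conv a′ b n
  conv-+ˡ a a′ b zero    = distribʳ (b 0) (a 0) (a′ 0)
  conv-+ˡ a a′ b (suc n) = begin
    (a 0 + a′ 0) * b (suc n) + conv (λ i → a (suc i) + a′ (suc i)) b n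
      ≈⟨ +-congˡ (conv-+ˡ (λ i → a (suc i)) (λ i → a′ (suc i)) b n) ⟩
    (a 0 + a′ 0) * b (suc n) + (conv (λ i → a (suc i)) b n + conv (λ i → a′ (suc i)) b n)
      ≈⟨ solve 5 (λ x x′ y s t → (x :+ x′) :* y :+ (s :+ t) := (x :* y :+ s) :+ (x′ :* y :+ t))
           ≈-refl (a 0) (a′ 0) (b (suc n)) _ _ ⟩
    conv a b (suc n) + conv a′ b (suc n) ∎

  conv-*ˡ : ∀ a b x n → conv (λ i → a i * x) b n ≈ conv a b n * x
  conv-*ˡ a b x zero    = solve 3 (λ p q r → (p :* r) :* q := (p :* q) :* r) ≈-refl (a 0) (b 0) x
  conv-*ˡ a b x (suc n) = begin
    a 0 * x * b (suc n) + conv (λ i → a (suc i) * x) b n   ≈⟨ +-congˡ (conv-*ˡ (λ i → a (suc i)) b x n) ⟩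
    a 0 * x * b (suc n) + conv (λ i → a (suc i)) b n * x
      ≈⟨ solve 4 (λ p q r s → p :* r :* q :+ s :* r := (p :* q :+ s) :* r) ≈-refl (a 0) (b (suc n)) x _ ⟩
    conv a b (suc n) * x                                   ∎

  conv-*ʳ : ∀ a b x n → conv a (λ i → b i * x) n ≈ conv a b n * x
  conv-*ʳ a b x zero    = ≈-sym (*-assoc (a 0) (b 0) x)
  conv-*ʳ a b x (suc n) = begin
    a 0 * (b (suc n) * x) + conv (λ i → a (suc i)) (λ i → b i * x) n   ≈⟨ +-congˡ (conv-*ʳ (λ i → a (suc i)) b x n) ⟩
    a 0 * (b (suc n) * x) + conv (λ i → a (suc i)) b n * x
      ≈⟨ solve 4 (λ p q r s → p :* (q :* r) :+ s :* r := (p :* q :+ s) :* r) ≈-refl (a 0) (b (suc n)) x _ ⟩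
    conv a b (suc n) * x                                               ∎

  -- The Leibniz rule for a product of power series. Of the `N` copies of `conv a⁺ b (suc n)`, one
  -- is unfolded and the other `suc n` form `D (conv a⁺ b) n`, to which induction applies.
  D-conv : ∀ a b n → D (conv a b) n ≈ conv (D a) b n + conv a (D b) n
  D-conv a b zero    =
    solve 4 (λ a₀ a₁ b₀ b₁ → (a₀ :* b₁ :+ a₁ :* b₀) :+ con 0 := (a₁ :+ con 0) :* b₀ :+ a₀ :* (b₁ :+ con 0))
      ≈-refl (a 0) (a 1) (b 0) (b 1)
  D-conv a b (suc n) = begin
    N · (a 0 * b N + conv a⁺ b (suc n))
      ≈⟨ ·-distrib-+ _ _ N ⟩
    N · (a 0 * b N) + (conv a⁺ b (suc n) + D (conv a⁺ b) n)
      ≈⟨ +-cong (≈-sym (·-comm-* N (a 0) (b N))) (+-congˡ (D-conv a⁺ b n)) ⟩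
    a 0 * N · b N + ((a 1 * b (suc n) + conv a⁺⁺ b n) + (conv (D a⁺) b n + conv a⁺ (D b) n))
      -- By definition `D a (suc i)` is `a⁺⁺ i + D a⁺ i`, and `D a 0` is `a 1 + 0#`, whence the
      -- `con 0`.
      ≈⟨ solve 7 (λ a₀ y a₁ b₁ p q r → a₀ :* y :+ ((a₁ :* b₁ :+ p) :+ (q :+ r)) := (a₁ :+ con 0) :* b₁ :+ (p :+ q) :+ (a₀ :* y :+ r))
           ≈-refl (a 0) (N · b N) (a 1) (b (suc n)) (conv a⁺⁺ b n) (conv (D a⁺) b n) (conv a⁺ (D b) n) ⟩
    (a 1 + 0#) * b (suc n) + (conv a⁺⁺ b n + conv (D a⁺) b n) + (a 0 * N · b N + conv a⁺ (D b) n)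
      ≈⟨ +-congʳ (+-congˡ (conv-+ˡ a⁺⁺ (D a⁺) b n)) ⟨
    conv (D a) b (suc n) + conv a (D b) (suc n) ∎
    where
    N = suc (suc n)
    a⁺ a⁺⁺ : ℕ → Carrier
    a⁺ i  = a (suc i)
    a⁺⁺ i = a (suc (suc i))

  -- `psum` grows at its end, whereas the recursion for the defect removes the first term.
  psum-front : ∀ a n → psum a (suc n) ≈ a 0 + psum (λ i → a (suc i)) n
  psum-front a zero    = +-comm 0# (a 0)
  psum-front a (suc n) = ≈-trans (+-congʳ (psum-front a n)) (+-assoc (a 0) _ _)

  psum-conv : ∀ a b n → psum (conv a b) (suc n) ≈ a 0 * psum b (suc n) + psum (conv (λ i → a (suc i)) b) n
  psum-conv a b zero    = solve 2 (λ p q → con 0 :+ p :* q := p :* (con 0 :+ q) :+ con 0) ≈-refl (a 0) (b 0)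
  psum-conv a b (suc n) = ≈-trans (+-congʳ (psum-conv a b n))
    (solve 5 (λ x s y t u → (x :* s :+ t) :+ (x :* y :+ u) := x :* (s :+ y) :+ (t :+ u)) ≈-refl
      (a 0) (psum b (suc n)) (b (suc n)) _ _)

  -- The defect of the Cauchy product when the sum of b is replaced by W.
  defect : (ℕ → Carrier) → (ℕ → Carrier) → Carrier → ℕ → Carrier
  defect a b W n = psum a n * W - psum (conv a b) n

  -- Unrolled, this writes the defect as the sum over `i < n` of `a i * (W - psum b (n - i))`; all
  -- later estimates rest on this form.
  defect-suc : ∀ a b W n →
    defect a b W (suc n) ≈ a 0 * (W - psum b (suc n)) + defect (λ i → a (suc i)) b W n
  defect-suc a b W n = begin
    psum a (suc n) * W - psum (conv a b) (suc n)
      ≈⟨ +-cong (*-congʳ (psum-front a n)) (-‿cong (psum-conv a b n)) ⟩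
    (a 0 + psum a⁺ n) * W - (a 0 * psum b (suc n) + psum (conv a⁺ b) n)
      -- The semiring solver has no negation, so the minus signs are first moved onto single terms,
      -- which it then treats as variables.
      ≈⟨ +-congˡ (≈-sym (⁻¹-∙-comm _ _)) ⟩
    (a 0 + psum a⁺ n) * W + (- (a 0 * psum b (suc n)) - psum (conv a⁺ b) n)
      ≈⟨ +-congˡ (+-congʳ (-‿distribʳ-* _ _)) ⟩
    (a 0 + psum a⁺ n) * W + (a 0 * - psum b (suc n) - psum (conv a⁺ b) n)
      ≈⟨ solve 5 (λ x s w t u → (x :+ s) :* w :+ (x :* t :+ u) := x :* (w :+ t) :+ (s :* w :+ u))
           ≈-refl (a 0) (psum a⁺ n) W (- psum b (suc n)) (- psum (conv a⁺ b) n) ⟩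
    a 0 * (W - psum b (suc n)) + defect a⁺ b W n ∎
    where
    a⁺ : ℕ → Carrier
    a⁺ i = a (suc i)

-- Complex rationals and the convolution of exponential terms.

open import Data.Rational.Base
open import Data.Rational.Properties
open import Data.Rational.Solver using (module +-*-Solver)

open +-*-Solver using (solve; con; _:=_; _:+_; _:*_; _:-_)

p≤∣p∣ : ∀ p → p ≤ ∣ p ∣
p≤∣p∣ p with ≤-total 0ℚ p
... | inj₁ 0≤p = ≤-reflexive (sym (0≤p⇒∣p∣≡p 0≤p))
... | inj₂ p≤0 = ≤-trans p≤0 (0≤∣p∣ p)

-- Subtraction in this ring computes to `_⊖_`, so defects can be measured directly with `‖_‖`.
ℚ[i]-commutativeRing : CommutativeRing 0ℓ 0ℓ
ℚ[i]-commutativeRing = record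
  { Carrier = ℚ[i] ; _≈_ = _≡_ ; _+_ = _⊕_ ; _*_ = _⊗_ ; -_ = λ (a , b) → - a , - b
  ; 0# = 0ℚ , 0ℚ ; 1# = 1ℚ , 0ℚ
  ; isCommutativeRing = record
    { isRing = record
      { +-isAbelianGroup = record
        { isGroup = record
          { isMonoid = record
            { isSemigroup = record
              { isMagma = record { isEquivalence = isEquivalence ; ∙-cong = cong₂ _⊕_ }
              ; assoc = λ (a , b) (c , d) (e , f) → cong₂ _,_ (+-assoc a c e) (+-assoc b d f) }
            ; identity = (λ (a , b) → cong₂ _,_ (+-identityˡ a) (+-identityˡ b))
                       , (λ (a , b) → cong₂ _,_ (+-identityʳ a) (+-identityʳ b)) }
          ; inverse = (λ (a , b) → cong₂ _,_ (+-inverseˡ a) (+-inverseˡ b))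
                    , (λ (a , b) → cong₂ _,_ (+-inverseʳ a) (+-inverseʳ b))
          ; ⁻¹-cong = cong λ (a , b) → - a , - b }
        ; comm = λ (a , b) (c , d) → cong₂ _,_ (+-comm a c) (+-comm b d) }
      ; *-cong = cong₂ _⊗_
      ; *-assoc = ⊗-assoc
      ; *-identity = ⊗-identityˡ , λ u → trans (⊗-comm u _) (⊗-identityˡ u)
      ; distrib = ⊗-distribˡ-⊕
                , λ u v w → trans (⊗-comm (v ⊕ w) u)
                           (trans (⊗-distribˡ-⊕ u v w) (cong₂ _⊕_ (⊗-comm u v) (⊗-comm u w))) }
    ; *-comm = ⊗-comm } }

open Convolution ℚ[i]-commutativeRing

private
  module Q = CommutativeRing ℚ[i]-commutativeRing

open import Algebra.Definitions.RawMonoid Q.+-rawMonoid using () renaming (_×_ to _·_)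

·-as-• : ∀ n u → n · u ≡ ι n • u
·-as-• zero    (a , b) = sym (cong₂ _,_ (*-zeroˡ a) (*-zeroˡ b))
·-as-• (suc n) (a , b) = trans (cong ((a , b) ⊕_) (·-as-• n (a , b))) (cong₂ _,_ (step a) (step b))
  where
  step : ∀ a → a + ι n * a ≡ ι (suc n) * a
  step a = trans (solve 2 (λ a i → a :+ i :* a := (con 1ℚ :+ i) :* a) refl a (ι n))
                 (cong (_* a) (sym (ι-suc n)))

1/suc•suc· : ∀ n u → (+ 1 / suc n) • (suc n · u) ≡ u
1/suc•suc· n u@(a , b) = trans (cong ((+ 1 / suc n) •_) (·-as-• (suc n) u)) (cong₂ _,_ (cancel a) (cancel b))
  where
  cancel : ∀ a → (+ 1 / suc n) * (ι (suc n) * a) ≡ a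
  cancel a = trans (sym (*-assoc (+ 1 / suc n) (ι (suc n)) a))
            (trans (cong (_* a) (1/suc*ι n)) (*-identityˡ a))

suc·1/suc• : ∀ n u → suc n · ((+ 1 / suc n) • u) ≡ u
suc·1/suc• n u@(a , b) = trans (·-as-• (suc n) _) (cong₂ _,_ (cancel a) (cancel b))
  where
  cancel : ∀ a → ι (suc n) * ((+ 1 / suc n) * a) ≡ a
  cancel a = trans (solve 3 (λ i r a → i :* (r :* a) := (r :* i) :* a) refl (ι (suc n)) (+ 1 / suc n) a)
            (trans (cong (_* a) (1/suc*ι n)) (*-identityˡ a))

terms : ℚ[i] → ℕ → ℚ[i]
terms z k = expTerm k z

-- The differential equation `E′ = z E` of `E(t) = exp(z t)`, read off coefficientwise.
D-terms : ∀ z k → D (terms z) k ≡ terms z k ⊗ z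
D-terms z k = suc·1/suc• k (expTerm k z ⊗ z)

expSum-psum : ∀ n z → expSum n z ≡ psum (terms z) n
expSum-psum zero    z = refl
expSum-psum (suc n) z = cong (_⊕ expTerm n z) (expSum-psum n z)

-- Both sides satisfy the recurrence (n + 1) c (n + 1) = (z ⊕ w) c n.
conv-terms : ∀ z w n → conv (terms z) (terms w) n ≡ terms (z ⊕ w) n
conv-terms z w zero    = refl
conv-terms z w (suc n) = begin
  c (suc n)                                          ≡⟨ 1/suc•suc· n (c (suc n)) ⟨
  r • D c n                                          ≡⟨ cong (r •_) (D-conv (terms z) (terms w) n) ⟩
  r • (conv (D (terms z)) (terms w) n ⊕ conv (terms z) (D (terms w)) n)
    ≡⟨ cong (r •_) (cong₂ _⊕_
         (trans (conv-cong (D-terms z) (λ _ → refl) n) (conv-*ˡ (terms z) (terms w) z n))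
         (trans (conv-cong (λ _ → refl) (D-terms w) n) (conv-*ʳ (terms z) (terms w) w n))) ⟩
  r • (c n ⊗ z ⊕ c n ⊗ w)                            ≡⟨ cong (r •_) (⊗-distribˡ-⊕ (c n) z w) ⟨
  r • (c n ⊗ (z ⊕ w))                                ≡⟨ cong (λ u → r • (u ⊗ (z ⊕ w))) (conv-terms z w n) ⟩
  terms (z ⊕ w) (suc n)                              ∎
  where
  open ≡-Reasoning
  r = + 1 / suc n
  c = conv (terms z) (terms w)

psum-cong : ∀ {a b} → (∀ k → a k ≡ b k) → ∀ n → psum a n ≡ psum b n
psum-cong a≡b zero    = refl
psum-cong a≡b (suc n) = cong₂ _⊕_ (psum-cong a≡b n) (a≡b n)

-- Norm estimates for the defect.

module _ (b : ℕ → ℚ[i]) (W : ℚ[i]) {β : ℚ} (W-b≤β : ∀ k → ‖ W ⊖ psum b k ‖ ≤ β) where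

  open ≤-Reasoning

  defect-step : ∀ {x y} a n → 0ℚ ≤ x → ‖ a 0 ‖ ≤ x → ‖ W ⊖ psum b (suc n) ‖ ≤ y →
    ‖ defect a b W (suc n) ‖ ≤ y * x + ‖ defect (λ i → a (suc i)) b W n ‖
  defect-step {x} {y} a n 0≤x a₀≤x W-b≤y = begin
    ‖ defect a b W (suc n) ‖                                 ≡⟨ cong ‖_‖ (defect-suc a b W n) ⟩
    ‖ a 0 ⊗ (W ⊖ psum b (suc n)) ⊕ d ‖                       ≤⟨ ‖⊕‖ (a 0 ⊗ (W ⊖ psum b (suc n))) d ⟩
    ‖ a 0 ⊗ (W ⊖ psum b (suc n)) ‖ + ‖ d ‖                   ≤⟨ +-monoˡ-≤ ‖ d ‖ (‖⊗‖ (a 0) (W ⊖ psum b (suc n))) ⟩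
    ‖ a 0 ‖ * ‖ W ⊖ psum b (suc n) ‖ + ‖ d ‖                 ≤⟨ +-monoˡ-≤ ‖ d ‖ (*-mono 0≤‖ W ⊖ psum b (suc n) ‖ 0≤x a₀≤x W-b≤y) ⟩
    x * y + ‖ d ‖                                            ≡⟨ cong (_+ ‖ d ‖) (*-comm x y) ⟩
    y * x + ‖ d ‖                                            ∎
    where d = defect (λ i → a (suc i)) b W n

  -- The norms of the terms are dominated by increments of `T`, so the bounds telescope. Shifting
  -- `a` shifts `T` along with it, which is why `T 0` is left arbitrary.
  ‖defect‖≤ : ∀ a (T : ℕ → ℚ) → (∀ i → ‖ a i ‖ ≤ T (suc i) - T i) → ∀ n →
    ‖ defect a b W n ‖ ≤ β * (T n - T 0)
  ‖defect‖≤ a T a≤ zero    = ≤-reflexive (trans (cong ‖_‖ (defect-zero W))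
    (solve 2 (λ β t → con 0ℚ := β :* (t :- t)) refl β (T 0)))
    where
    defect-zero : ∀ W → defect a b W 0 ≡ (0ℚ , 0ℚ)
    defect-zero W = trans (Q.+-identityʳ _) (Q.zeroˡ W)
  ‖defect‖≤ a T a≤ (suc n) = begin
    ‖ defect a b W (suc n) ‖
      ≤⟨ defect-step a n (≤-trans 0≤‖ a 0 ‖ (a≤ 0)) (a≤ 0) (W-b≤β (suc n)) ⟩
    β * (T 1 - T 0) + ‖ defect (λ i → a (suc i)) b W n ‖
      ≤⟨ +-monoʳ-≤ (β * (T 1 - T 0)) (‖defect‖≤ (λ i → a (suc i)) (λ i → T (suc i)) (λ i → a≤ (suc i)) n) ⟩
    β * (T 1 - T 0) + β * (T (suc n) - T 1)
      ≡⟨ solve 4 (λ β t s u → β :* (s :- t) :+ β :* (u :- s) := β :* (u :- t)) refl β (T 0) (T 1) (T (suc n)) ⟩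
    β * (T (suc n) - T 0) ∎

  -- In the unrolled defect the first `j` terms meet partial sums of `b` with index above `N`, where
  -- `η` applies; for the last `N` terms the uniform bound `β` remains.
  ‖defect‖≤-tail : ∀ {N η} → (∀ {k} → N ℕ.≤ k → ‖ W ⊖ psum b k ‖ ≤ η) →
    ∀ a (T : ℕ → ℚ) → (∀ i → ‖ a i ‖ ≤ T (suc i) - T i) → ∀ j →
    ‖ defect a b W (j ℕ.+ N) ‖ ≤ η * (T j - T 0) + β * (T (j ℕ.+ N) - T j)
  ‖defect‖≤-tail {N} {η} tail a T a≤ zero    = ≤-trans (‖defect‖≤ a T a≤ N)
    (≤-reflexive (solve 3 (λ η t x → x := η :* (t :- t) :+ x) refl η (T 0) (β * (T N - T 0))))
  ‖defect‖≤-tail {N} {η} tail a T a≤ (suc j) = begin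
    ‖ defect a b W (suc n) ‖
      ≤⟨ defect-step a n (≤-trans 0≤‖ a 0 ‖ (a≤ 0)) (a≤ 0) (tail (ℕₚ.m≤n+m N (suc j))) ⟩
    η * (T 1 - T 0) + ‖ defect (λ i → a (suc i)) b W n ‖
      ≤⟨ +-monoʳ-≤ (η * (T 1 - T 0)) (‖defect‖≤-tail tail (λ i → a (suc i)) (λ i → T (suc i)) (λ i → a≤ (suc i)) j) ⟩
    η * (T 1 - T 0) + (η * (T (suc j) - T 1) + x)
      ≡⟨ solve 5 (λ η t s u x → η :* (s :- t) :+ (η :* (u :- s) :+ x) := η :* (u :- t) :+ x) refl η (T 0) (T 1) (T (suc j)) x ⟩
    η * (T (suc j) - T 0) + x ∎
    where
    n = j ℕ.+ N
    x = β * (T (suc n) - T (suc j))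

-- Products of truncated exponential series.

module _ {B : ℚ} (0≤B : 0ℚ ≤ B) where

  open Majorant 0≤B
  open ≤-Reasoning

  expTerm-real : ∀ k → expTerm k (B , 0ℚ) ≡ (term k , 0ℚ)
  expTerm-real zero    = refl
  expTerm-real (suc k) = trans (cong (λ u → r • (u ⊗ (B , 0ℚ))) (expTerm-real k)) (cong₂ _,_
    (solve 3 (λ r t b → r :* (t :* b :- con 0ℚ :* con 0ℚ) := r :* (t :* b)) refl r (term k) B)
    (solve 3 (λ r t b → r :* (t :* con 0ℚ :+ con 0ℚ :* b) := con 0ℚ) refl r (term k) B))
    where r = + 1 / suc k

  expSum-real : ∀ n → proj₁ (expSum n (B , 0ℚ)) ≡ total n
  expSum-real zero    = refl
  expSum-real (suc n) = cong₂ _+_ (expSum-real n) (cong proj₁ (expTerm-real n))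

  -- The majorant is the exponential series at the real argument `B`, so the convergence built into
  -- `exp` can be reused.
  total-cauchy : Cauchy total
  total-cauchy {ε} 0<ε = let N , close = cauchy (re (exp (fromℝ (fromℚ B)))) 0<ε in
    N , λ {m} {n} N≤m N≤n →
      subst₂ (λ p q → ∣ p - q ∣ < ε) (expSum-real m) (expSum-real n) (close N≤m N≤n)

  -- The threshold is uniform in `u` and `v`, because in `exp` the rational arguments vary with the
  -- truncation index.
  expSum-⊗-defect : ∀ {δ} → 0ℚ < δ → ∃ λ N → ∀ u v → ‖ u ‖ ≤ B → ‖ v ‖ ≤ B → ∀ {n} → N ℕ.≤ n →
    ‖ expSum n u ⊗ expSum n v ⊖ expSum n (u ⊕ v) ‖ ≤ (closeness * bound + (bound + bound)) * δ
  -- Of the `n` indices, the first `j` meet partial sums of `v` from `N` on; the other `N` carry the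
  -- weight `total (j ℕ.+ N) - total j`, which is small because `j` is at least `M`.
  expSum-⊗-defect {δ} 0<δ = M ℕ.+ N , λ u v u≤B v≤B {n} M+N≤n →
    let j    = n ℕ.∸ N
        M≤j  = ℕₚ.m+n≤o⇒m≤o∸n M M+N≤n
        N≤n  = ℕₚ.m+n≤o⇒n≤o M M+N≤n
        j+N≡n = ℕₚ.m∸n+n≡m N≤n
    in begin
    ‖ expSum n u ⊗ expSum n v ⊖ expSum n (u ⊕ v) ‖
      ≡⟨ cong ‖_‖ (cong₂ _⊖_ (cong (_⊗ expSum n v) (expSum-psum n u))
           (trans (expSum-psum n (u ⊕ v)) (sym (psum-cong (conv-terms u v) n)))) ⟩
    -- With the truncation `expSum n v` itself as `W`, the difference is exactly a defect.
    ‖ defect (terms u) (terms v) (expSum n v) n ‖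
      ≡⟨ cong (λ k → ‖ defect (terms u) (terms v) (expSum n v) k ‖) j+N≡n ⟨
    ‖ defect (terms u) (terms v) (expSum n v) (j ℕ.+ N) ‖
      ≤⟨ ‖defect‖≤-tail (terms v) (expSum n v) (distance v v≤B n)
           (λ {k} N≤k → distance-tail v v≤B N≤n N≤k) (terms u) total (terms≤ u u≤B) j ⟩
    closeness * δ * (total j - total 0) + (bound + bound) * (total (j ℕ.+ N) - total j)
      ≤⟨ +-mono-≤ (*-monoˡ (0≤* 0≤closeness (<⇒≤ 0<δ)) (≤-trans (≤-reflexive (+-identityʳ (total j))) (total≤bound j)))
           (*-monoˡ (0≤+ 0≤bound 0≤bound) (≤-trans (p≤∣p∣ _)
             (<⇒≤ (proj₂ (total-cauchy 0<δ) (subst (M ℕ.≤_) (sym j+N≡n) (ℕₚ.m+n≤o⇒m≤o M M+N≤n)) M≤j)))) ⟩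
    closeness * δ * bound + (bound + bound) * δ
      ≡⟨ solve 3 (λ c b d → c :* d :* b :+ (b :+ b) :* d := (c :* b :+ (b :+ b)) :* d) refl closeness bound δ ⟩
    (closeness * bound + (bound + bound)) * δ ∎
    where
    M = proj₁ (total-cauchy 0<δ)
    N = proj₁ (expSum-close 0<δ)

    terms≤ : ∀ u → ‖ u ‖ ≤ B → ∀ i → ‖ terms u i ‖ ≤ total (suc i) - total i
    terms≤ u u≤B i = ≤-trans (‖expTerm‖≤ u u≤B i)
      (≤-reflexive (solve 2 (λ t s → t := (s :+ t) :- s) refl (term i) (total i)))

    from-start : ∀ v → ‖ v ‖ ≤ B → ∀ k → ‖ expSum k v ⊖ expSum 0 v ‖ ≤ bound
    -- `total 0` is zero, so adding it through `p≤p+q ≤-refl` gives the left side of `expSum-tail`.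
    from-start v v≤B k = ≤-trans (≤-trans (p≤p+q ≤-refl) (expSum-tail v v≤B {n = k} ℕ.z≤n)) (total≤bound k)

    distance : ∀ v → ‖ v ‖ ≤ B → ∀ n k → ‖ expSum n v ⊖ psum (terms v) k ‖ ≤ bound + bound
    distance v v≤B n k = begin
      ‖ expSum n v ⊖ psum (terms v) k ‖                          ≡⟨ cong (λ s → ‖ expSum n v ⊖ s ‖) (expSum-psum k v) ⟨
      ‖ expSum n v ⊖ expSum k v ‖                                ≤⟨ ‖⊖‖-triangle (expSum n v) (expSum 0 v) (expSum k v) ⟩
      ‖ expSum n v ⊖ expSum 0 v ‖ + ‖ expSum 0 v ⊖ expSum k v ‖
        ≤⟨ +-mono-≤ (from-start v v≤B n)
             (≤-trans (≤-reflexive (‖⊖‖-swap (expSum 0 v) (expSum k v))) (from-start v v≤B k)) ⟩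
      bound + bound                                              ∎

    distance-tail : ∀ v → ‖ v ‖ ≤ B → ∀ {n k} → N ℕ.≤ n → N ℕ.≤ k →
      ‖ expSum n v ⊖ psum (terms v) k ‖ ≤ closeness * δ
    distance-tail v v≤B {n} {k} N≤n N≤k = subst (λ s → ‖ expSum n v ⊖ s ‖ ≤ closeness * δ) (expSum-psum k v)
      (proj₂ (expSum-close 0<δ) v v v≤B v≤B
        (≤-trans (≤-reflexive (‖⊖‖-refl v)) (0≤* (nonNegative⁻¹ 2ℚ) (<⇒≤ 0<δ))) N≤n N≤k)

-- The functional equation of the exponential.

≈ᶜ-up-to : ∀ {z w C} → 0ℚ ≤ C →
  (∀ {δ} → 0ℚ < δ → ∃ λ N → ∀ {n} → N ℕ.≤ n → ‖ z at n ⊖ w at n ‖ ≤ C * δ) → z ≈ᶜ w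
≈ᶜ-up-to {z} {w} 0≤C est .re≈ = ≈-up-to 0≤C λ 0<δ → let N , bnd = est 0<δ in
  N , λ {n} N≤n → ≤-trans (≤‖‖ˡ (z at n ⊖ w at n)) (bnd N≤n)
≈ᶜ-up-to {z} {w} 0≤C est .im≈ = ≈-up-to 0≤C λ 0<δ → let N , bnd = est 0<δ in
  N , λ {n} N≤n → ≤-trans (≤‖‖ʳ (z at n ⊖ w at n)) (bnd N≤n)

-- At index `n` both sides are truncated series at `z at n`, `w at n` and their sum, so the uniform
-- estimate applies; `A + B` eventually bounds both arguments.
exp-homo-+ : ∀ z w → exp (z +ᶜ w) ≈ᶜ exp z *ᶜ exp w
exp-homo-+ z w =
  let A , 0≤A , K , z≤A = eventually-boundedᶜ z
      B , 0≤B , L , w≤B = eventually-boundedᶜ w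
      0≤A+B = 0≤+ 0≤A 0≤B
      module M = Majorant 0≤A+B
  in ℂR.sym (≈ᶜ-up-to (0≤+ (0≤* M.0≤closeness M.0≤bound) (0≤+ M.0≤bound M.0≤bound)) λ 0<δ →
  let N , bnd = expSum-⊗-defect 0≤A+B 0<δ
      KL = K ℕ.⊔ L
  in N ℕ.⊔ KL , λ {n} ≤n →
  let KL≤n = ℕₚ.m⊔n≤o⇒n≤o N KL ≤n
  in bnd (z at n) (w at n)
       (≤-trans (z≤A (ℕₚ.m⊔n≤o⇒m≤o K L KL≤n)) (p≤p+q 0≤B))
       (≤-trans (w≤B (ℕₚ.m⊔n≤o⇒n≤o K L KL≤n)) (p≤q+p 0≤A))
       (ℕₚ.m⊔n≤o⇒m≤o N KL ≤n))

e^𝕚-homo-+ : ∀ x y → e^𝕚 (x +ᴿ y) ≈ᶜ e^𝕚 x *ᶜ e^𝕚 y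
e^𝕚-homo-+ x y = ℂR.trans (exp-cong (ℂR.trans (*ᶜ-cong {𝕚} ℂR.refl fromℝ-homo-+) (ℂR.distribˡ 𝕚 (fromℝ x) (fromℝ y))))
  (exp-homo-+ (𝕚 *ᶜ fromℝ x) (𝕚 *ᶜ fromℝ y))
  where
  fromℝ-homo-+ : fromℝ (x +ᴿ y) ≈ᶜ fromℝ x +ᶜ fromℝ y
  fromℝ-homo-+ = record { re≈ = ≈ᴿ-refl ; im≈ = ≈ᴿ-sym (ℝR.+-identityˡ 0ᴿ) }

-- Phases at the ends of an edge and gauge invariance.

e^𝕚-*-cong : ∀ {w x y z} → w +ᴿ x ≈ᴿ y +ᴿ z → e^𝕚 w *ᶜ e^𝕚 x ≈ᶜ e^𝕚 y *ᶜ e^𝕚 z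
e^𝕚-*-cong {w} {x} {y} {z} eq =
  ℂR.trans (ℂR.sym (e^𝕚-homo-+ w x)) (ℂR.trans (e^𝕚-cong eq) (e^𝕚-homo-+ y z))

-- The contribution of one end of an edge: `t` and `c` are the values of `f` and `g` there, `s` is
-- the value of `f` at the other end, and `a` is the potential of the edge leaving this end.
gauge-end : ∀ a s t c → e^𝕚 ((a +ᴿ (s +ᴿ -ᴿ t)) /2) *ᶜ (e^𝕚 t *ᶜ c) ≈ᶜ e^𝕚 ((s +ᴿ t) /2) *ᶜ (e^𝕚 (a /2) *ᶜ c)
gauge-end a s t c = begin
  e^𝕚 ((a +ᴿ (s +ᴿ -ᴿ t)) /2) *ᶜ (e^𝕚 t *ᶜ c)   ≈⟨ ℂR.*-assoc _ _ c ⟨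
  e^𝕚 ((a +ᴿ (s +ᴿ -ᴿ t)) /2) *ᶜ e^𝕚 t *ᶜ c     ≈⟨ ℂR.*-congʳ (e^𝕚-*-cong half) ⟩
  e^𝕚 ((s +ᴿ t) /2) *ᶜ e^𝕚 (a /2) *ᶜ c          ≈⟨ ℂR.*-assoc _ _ c ⟩
  e^𝕚 ((s +ᴿ t) /2) *ᶜ (e^𝕚 (a /2) *ᶜ c)        ∎
  where
  open SetoidReasoning ℂR.setoid
  half : (a +ᴿ (s +ᴿ -ᴿ t)) /2 +ᴿ t ≈ᴿ (s +ᴿ t) /2 +ᴿ a /2
  half = pointwise λ n →
    solve 3 (λ a s t → con ½ :* (a :+ (s :- t)) :+ t := con ½ :* (s :+ t) :+ con ½ :* a) refl (seq a n) (seq s n) (seq t n)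

proposition3p1 : ∀ {v e : Level} (M : MagneticGraph v e) →
    let open MagneticGraph M in
    (f : Vertex → ℝ) (g : Vertex → ℂ) →
    d⁰[ α +ˢ d⁰ f ] (gauge⁰ f g) ≈ˢ gauge¹ f (d⁰[ α ] g)
proposition3p1 M f g x y xy = begin
  e^𝕚 ((αyx +ᴿ (f x +ᴿ -ᴿ f y)) /2) *ᶜ (e^𝕚 (f y) *ᶜ g y) -ᶜ e^𝕚 ((αxy +ᴿ (f y +ᴿ -ᴿ f x)) /2) *ᶜ (e^𝕚 (f x) *ᶜ g x)
    ≈⟨ +ᶜ-cong (gauge-end αyx (f x) (f y) (g y)) (-ᶜ-cong (gauge-end αxy (f y) (f x) (g x))) ⟩
  e^𝕚 ((f x +ᴿ f y) /2) *ᶜ (e^𝕚 (αyx /2) *ᶜ g y) -ᶜ e^𝕚 ((f y +ᴿ f x) /2) *ᶜ (e^𝕚 (αxy /2) *ᶜ g x)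
    -- The two ends produce the sum of the values of `f` in opposite orders; commuting one of them
    -- makes the phase a common factor.
    ≈⟨ ℂR.+-congˡ (-ᶜ-cong (ℂR.*-congʳ (e^𝕚-cong (ℝR.*-congˡ (ℝR.+-comm (f y) (f x)))))) ⟩
  e^𝕚 ((f x +ᴿ f y) /2) *ᶜ (e^𝕚 (αyx /2) *ᶜ g y) -ᶜ e^𝕚 ((f x +ᴿ f y) /2) *ᶜ (e^𝕚 (αxy /2) *ᶜ g x)
    ≈⟨ x[y-z]≈xy-xz (e^𝕚 ((f x +ᴿ f y) /2)) (e^𝕚 (αyx /2) *ᶜ g y) (e^𝕚 (αxy /2) *ᶜ g x) ⟨
  e^𝕚 ((f x +ᴿ f y) /2) *ᶜ (e^𝕚 (αyx /2) *ᶜ g y -ᶜ e^𝕚 (αxy /2) *ᶜ g x) ∎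
  where
  open MagneticGraph M
  open SetoidReasoning ℂR.setoid
  open import Algebra.Properties.Ring ℂR.ring using (x[y-z]≈xy-xz)
  αxy = val α x y xy
  αyx = val α y x (edge-sym xy)
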